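{- For every positive integer $k$, every $k$-chromatic graph $G$ that is a minimal (with respect to the minor relation) counterexample to Hadwiger's Conjecture is $\lceil k/8\rceil$-connected.
   Context: Graphs are finite and simple. A graph $H$ is a minor of a graph $G$ if $H$ can be obtained from a subgraph of $G$ by contracting edges. A graph is $k$-chromatic if its chromatic number equals $k$. Hadwiger's Conjecture states that, for every $k$, every $k$-chromatic graph contains a $K_k$-minor. A counterexample to Hadwiger's Conjecture is a graph $H$ that has no $K_{\chi(H)}$-minor, where $\chi(H)$ is the chromatic number of $H$. It is minimal with respect to the minor relation if none of its proper minors is a counterexample. A graph is $m$-connected (vertex connectivity) if it has more than $m$ vertices and remains connected after the deletion of any set of fewer than $m$ vertices. -}

module Defs where

open import Data.Bool.Base using (Bool; T)
open import Data.Fin.Base using (Fin)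
open import Data.Fin.Properties using (_≟_)
open import Data.Fin.Subset using (Subset; ∣_∣; _∉_)
open import Data.Nat.Base using (ℕ; _+_; _≤_; _<_; _/_)
open import Data.Product.Base using (∃; ∃-syntax; ∃₂; _×_)
open import Data.Sum.Base using (_⊎_)
open import Function.Bundles using (_⇔_; _↔_; Inverse)
open import Function.Definitions using (Injective; Surjective)
open import Relation.Binary.Construct.Closure.ReflexiveTransitive using (Star)
open import Relation.Binary.Core using (Rel)
open import Relation.Binary.Definitions using (Symmetric; Irreflexive)
open import Relation.Binary.PropositionalEquality
  using (_≡_; _≢_; ≢-sym)
open import Relation.Nullary using (¬_)
open import Relation.Nullary.Decidable using (⌊_⌋; ¬?; toWitness; fromWitness)

-- Finite simple graphs on the vertex set Fin order.  Adjacency is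
-- Boolean-valued, so it is decidable and carries no edge multiplicity.
record Graph : Set where
  field
    order : ℕ
    adj   : Fin order → Fin order → Bool

  Vertex : Set
  Vertex = Fin order

  Adj : Rel Vertex _
  Adj x y = T (adj x y)

  field
    symmetric   : Symmetric Adj
    irreflexive : Irreflexive _≡_ Adj

open Graph public using (order; Vertex; Adj)

K : ℕ → Graph
K n = record
  { order       = n
  ; adj         = λ x y → ⌊ ¬? (x ≟ y) ⌋
  ; symmetric   = λ {x} {y} p →
      fromWitness {a? = ¬? (y ≟ x)} (≢-sym (toWitness {a? = ¬? (x ≟ y)} p))
  ; irreflexive = λ {x} {y} x≡y p → toWitness {a? = ¬? (x ≟ y)} p x≡y
  }

record _≅_ (G H : Graph) : Set where
  field
    bijection : Vertex G ↔ Vertex H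
    adjacency : ∀ x y →
      Adj G x y ⇔ Adj H (Inverse.to bijection x) (Inverse.to bijection y)

-- S is isomorphic to a (not necessarily induced) subgraph of G.
record _IsSubgraphOf_ (S G : Graph) : Set where
  field
    embed     : Vertex S → Vertex G
    injective : Injective _≡_ _≡_ embed
    preserves : ∀ {x y} → Adj S x y → Adj G (embed x) (embed y)

-- H is isomorphic to G / uv for some edge uv of G: the quotient map π
-- identifies u with v and nothing else, and the loops and parallel edges
-- that this creates are discarded.
record _ContractsTo_ (G H : Graph) : Set where
  field
    u v        : Vertex G
    edge       : Adj G u v
    π          : Vertex G → Vertex H
    surjective : Surjective _≡_ _≡_ π
    fibres     : ∀ x y →
      π x ≡ π y ⇔ (x ≡ y ⊎ (x ≡ u × y ≡ v) ⊎ (x ≡ v × y ≡ u))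
    adjacency  : ∀ a b →
      Adj H a b ⇔ (a ≢ b × ∃₂ λ x y → π x ≡ a × π y ≡ b × Adj G x y)

_IsMinorOf_ : Rel Graph _
H IsMinorOf G = ∃[ S ] (S IsSubgraphOf G × Star _ContractsTo_ S H)

-- Minors are taken up to isomorphism, hence so is properness.
_IsProperMinorOf_ : Rel Graph _
H IsProperMinorOf G = H IsMinorOf G × ¬ (H ≅ G)

Colourable : ℕ → Graph → Set
Colourable k G =
  ∃ λ (c : Vertex G → Fin k) → ∀ x y → Adj G x y → c x ≢ c y

Chromatic : ℕ → Graph → Set
Chromatic k G = Colourable k G × (∀ j → Colourable j G → k ≤ j)

HadwigerCounterexample : Graph → Set
HadwigerCounterexample H = ∃[ k ] (Chromatic k H × ¬ (K k IsMinorOf H))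

MinimalHadwigerCounterexample : Graph → Set
MinimalHadwigerCounterexample G =
  HadwigerCounterexample G ×
  (∀ H → H IsProperMinorOf G → ¬ HadwigerCounterexample H)

-- Adjacency in G − S.
AdjOutside : (G : Graph) → Subset (order G) → Rel (Vertex G) _
AdjOutside G S x y = x ∉ S × y ∉ S × Adj G x y

ConnectedOutside : (G : Graph) → Subset (order G) → Set
ConnectedOutside G S = ∀ x y → x ∉ S → y ∉ S → Star (AdjOutside G S) x y

-- Under the bound on the order, G − S is never empty, so it does not matter
-- that ConnectedOutside holds of the empty graph.
Connected : ℕ → Graph → Set
Connected m G = m < order G × (∀ S → ∣ S ∣ < m → ConnectedOutside G S)

⌈_/8⌉ : ℕ → ℕ
⌈ k /8⌉ = (k + 7) / 8

-- Let G be a minimal counterexample with χ(G) = k+1, and suppose that a set X of s vertices separates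
-- G into two sides, with 8s ≤ k and s minimal.  The side F of X is not (k-s)-colourable, as otherwise a
-- k-colouring of G - F would extend to G; since F satisfies Hadwiger's conjecture, it contains a
-- K_{2s} minor.  Because no fewer than s vertices separate X from this minor, G[F ∪ X] contains a
-- K_s minor rooted at X (Robertson and Seymour), so that G - F with X completed to a clique is a
-- proper minor of G.  It is k-colourable, and hence G - F has a k-colouring that is injective on X.
-- The same holds for the other side, and after a permutation of colours the two colourings agree on X
-- and give a k-colouring of G.
--
-- Both Menger's theorem and the rooted minor are obtained by contracting edges as long as no small
-- separation arises; when one does, it comes from a separation of order exactly s, whose two sides are
-- smaller graphs.  Everything is finite, but the existence statements are only used to refute
-- colourability, so they are proved under a double negation.

module Submission where

open import Defs
open import Data.Bool.Base using (true; false)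
open import Data.Bool.Properties using (T?)
open import Data.Empty using (⊥; ⊥-elim)
open import Data.Fin.Base using (Fin; fromℕ<; zero; suc; punchIn; punchOut; inject≤; splitAt; _↑ˡ_; _↑ʳ_)
open import Data.Fin.Permutation using (↔⇒≡)
open import Data.Fin.Permutation.Components using (transpose; transpose-inverse)
open import Data.Fin.Properties
  using (_≟_; any?; all?; ¬∀⟶∃¬; pigeonhole; injective⇒≤; inject≤-injective; suc-injective; <⇒≢;
         punchIn-injective; punchInᵢ≢i; punchIn-punchOut; punchOut-injective; punchOut-cong;
         punchOut-punchIn; splitAt-↑ˡ; splitAt-↑ʳ)
open import Data.Fin.Subset using (Subset; ∣_∣; _∈_; _∉_)
open import Data.Fin.Subset.Properties using (_∈?_)
open import Data.Maybe.Base as Maybe using (Maybe; just; nothing)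
open import Data.Maybe.Properties using (just-injective; ≡-dec)
open import Data.Nat.Base using (ℕ; zero; suc; NonZero; _+_; _*_; _≤_; _<_; z≤n; s≤s)
open import Data.Nat.DivMod using (m<n*o⇒m/o<n; m/n*n≤m)
open import Data.Nat.Properties
  using (≤-refl; ≤-trans; ≤-antisym; <-≤-trans; ≤-<-trans; ≤-pred; ≤-<-connex; <⇒≤; n≮n;
         m≤n⇒m<n∨m≡n; m≤m+n; m≤m*n; +-comm; +-assoc; +-identityʳ; +-suc; +-mono-≤; +-monoˡ-≤;
         +-monoʳ-<; +-cancelˡ-≤; *-comm; *-monoˡ-≤; module ≤-Reasoning)
open import Data.Product.Base using (Σ; ∃; ∃₂; _×_; _,_; proj₁; proj₂)
open import Data.Sum.Base using (_⊎_; inj₁; inj₂; [_,_]′)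
open import Data.Vec.Base using ([]; _∷_; here; there)
open import Function.Base using (_∘_; id)
open import Function.Bundles using (_⇔_; mk⇔; Equivalence)
open import Function.Definitions using (Injective)
open import Level using (0ℓ)
open import Relation.Binary.Construct.Closure.ReflexiveTransitive as Star using (Star; ε; _◅_; _◅◅_; gmap)
open import Relation.Binary.Core using (Rel)
open import Relation.Binary.PropositionalEquality
  using (_≡_; _≢_; refl; sym; trans; cong; subst; subst₂; ≢-sym)
open import Relation.Nullary using (¬_; Dec; yes; no)
open import Relation.Nullary.Decidable
  using (⌊_⌋; toWitness; fromWitness; ¬?; _×-dec_; _⊎-dec_; ¬¬-excluded-middle; map′;
         decidable-stable; dec-true; dec-false)

-- Double negation

infixl 1 _>>=_

-- With this bind, `do` reasons classically towards a doubly negated goal; a partial pattern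
-- followed by `where` is a case distinction.
_>>=_ : ∀ {a b} {A : Set a} {B : Set b} → ¬ ¬ A → (A → ¬ ¬ B) → ¬ ¬ B
(m >>= f) k = m λ a → f a k

return : ∀ {a} {A : Set a} → A → ¬ ¬ A
return a k = k a

¬¬-∀ : ∀ {n} {P : Fin n → Set} → (∀ i → ¬ ¬ P i) → ¬ ¬ (∀ i → P i)
¬¬-∀ {zero}  h = return λ ()
¬¬-∀ {suc n} h = do
  p ← h zero
  q ← ¬¬-∀ (h ∘ suc)
  return λ { zero → p ; (suc i) → q i }

decide : ∀ {n} (P : Fin n → Set) → ¬ ¬ (∀ x → Dec (P x))
decide P = ¬¬-∀ λ _ → ¬¬-excluded-middle

least : (P : ℕ → Set) → ∀ n → P n → ¬ ¬ (∃ λ m → P m × ∀ i → P i → m ≤ i)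
least P zero    p = return (0 , p , λ _ _ → z≤n)
least P (suc n) p = do
  yes p₀ ← ¬¬-excluded-middle {A = P 0}
    where no ¬p₀ → do
            m , pm , min ← least (P ∘ suc) n p
            return (suc m , pm , λ { zero q → ⊥-elim (¬p₀ q) ; (suc i) q → s≤s (min i q) })
  return (0 , p₀ , λ _ _ → z≤n)

-- Finite sets

injective-avoiding⇒< : ∀ {m n} {f : Fin m → Fin n} → Injective _≡_ _≡_ f →
                       ∀ x → (∀ i → x ≢ f i) → m < n
injective-avoiding⇒< {n = suc n} f-inj x x∉f =
  s≤s (injective⇒≤ {f = λ i → punchOut (x∉f i)} λ {i} {j} e →
    f-inj (punchOut-injective (x∉f i) (x∉f j) e))

injective⇒surjective : ∀ {n} {f : Fin n → Fin n} → Injective _≡_ _≡_ f → ∀ y → ∃ λ x → f x ≡ y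
injective⇒surjective {f = f} f-inj y with any? (λ x → f x ≟ y)
... | yes p = p
... | no ¬p = ⊥-elim (n≮n _ (injective-avoiding⇒< f-inj y λ i e → ¬p (i , sym e)))

-- If every value were hit, choosing an index for each of them would map `Fin p` injectively into
-- `Fin q`.
missed : ∀ {q p} → q < p → (f : Fin q → Maybe (Fin p)) → ∃ λ i → ∀ j → f j ≢ just i
missed {q} {p} q<p f = conclude (all? hit?)
  where
  Hit : Fin p → Set
  Hit i = ∃ λ j → f j ≡ just i
  hit? : ∀ i → Dec (Hit i)
  hit? i = any? λ j → ≡-dec _≟_ (f j) (just i)
  conclude : Dec (∀ i → Hit i) → ∃ λ i → ∀ j → f j ≢ just i
  conclude (no ¬h) = let i , n = ¬∀⟶∃¬ p Hit hit? ¬h in i , λ j e → n (j , e)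
  conclude (yes h) = let i , j , i<j , e = pigeonhole q<p (proj₁ ∘ h) in
    ⊥-elim (<⇒≢ i<j (just-injective
      (trans (sym (proj₂ (h i))) (trans (cong f e) (proj₂ (h j))))))

preimage : ∀ {m n} → (Fin m → Fin n) → Fin n → Maybe (Fin m)
preimage f y with any? (λ x → f x ≟ y)
... | yes (x , _) = just x
... | no _        = nothing

preimage-sound : ∀ {m n} (f : Fin m → Fin n) {x y} → preimage f y ≡ just x → f x ≡ y
preimage-sound f {y = y} e with any? (λ x → f x ≟ y)
preimage-sound f refl | yes (_ , p) = p

preimage-complete : ∀ {m n} {f : Fin m → Fin n} → Injective _≡_ _≡_ f →
                    ∀ x → preimage f (f x) ≡ just x
preimage-complete {f = f} f-inj x with any? (λ x′ → f x′ ≟ f x)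
... | yes (_ , p) = cong just (f-inj p)
... | no ¬p       = ⊥-elim (¬p (x , refl))

-- `index` accepts any proof of `P x` and `elem-index` holds for each, so `P` need not be
-- proof-irrelevant.
record Enumeration {n} (P : Fin n → Set) : Set where
  field
    size       : ℕ
    elem       : Fin size → Fin n
    injective  : Injective _≡_ _≡_ elem
    sound      : ∀ i → P (elem i)
    index      : ∀ x → P x → Fin size
    elem-index : ∀ x p → elem (index x p) ≡ x

  index-elem : ∀ i p → index (elem i) p ≡ i
  index-elem i p = injective (elem-index (elem i) p)

  index-injective : ∀ {x y p q} → index x p ≡ index y q → x ≡ y
  index-injective e = trans (sym (elem-index _ _)) (trans (cong elem e) (elem-index _ _))

  size< : ∀ x → ¬ P x → size < n
  size< x ¬px = injective-avoiding⇒< injective x λ i e → ¬px (subst P (sym e) (sound i))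

open Enumeration using (elem; index; sound; elem-index)

enumerate : ∀ {n} {P : Fin n → Set} → (∀ x → Dec (P x)) → Enumeration P
enumerate {zero}  P? = record
  { size = 0 ; elem = λ () ; injective = λ {} ; sound = λ () ; index = λ () ; elem-index = λ () }
enumerate {suc n} {P} P? with enumerate (P? ∘ suc) | P? zero
... | e | no ¬p = record
  { size       = E.size
  ; elem       = suc ∘ E.elem
  ; injective  = E.injective ∘ suc-injective
  ; sound      = E.sound
  ; index      = λ { zero p → ⊥-elim (¬p p) ; (suc x) p → E.index x p }
  ; elem-index = λ { zero p → ⊥-elim (¬p p) ; (suc x) p → cong suc (E.elem-index x p) }
  }
  where module E = Enumeration e
... | e | yes p₀ = record
  { size       = suc E.size
  ; elem       = λ { zero → zero ; (suc i) → suc (E.elem i) }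
  ; injective  = λ { {zero} {zero} _ → refl
                   ; {zero} {suc _} ()
                   ; {suc _} {zero} ()
                   ; {suc _} {suc _} e → cong suc (E.injective (suc-injective e)) }
  ; sound      = λ { zero → p₀ ; (suc i) → E.sound i }
  ; index      = λ { zero _ → zero ; (suc x) p → suc (E.index x p) }
  ; elem-index = λ { zero _ → refl ; (suc x) p → cong suc (E.elem-index x p) }
  }
  where module E = Enumeration e

-- The quotient of `Fin n` that glues `v` to `u`, with the points other than `v` as representatives.
record Merge {n} (u v : Fin n) : Set where
  field
    size      : ℕ
    size<     : size < n
    π         : Fin n → Fin size
    section   : Fin size → Fin n
    π-section : ∀ a → π (section a) ≡ a
    section≢v : ∀ a → section a ≢ v
    π-u≡v     : π u ≡ π v
    fibre     : ∀ x y → π x ≡ π y → x ≡ y ⊎ (x ≡ u × y ≡ v) ⊎ (x ≡ v × y ≡ u)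

merge : ∀ {n} {u v : Fin n} → u ≢ v → Merge u v
merge {suc n} {u} {v} u≢v = record
  { size = n ; size< = ≤-refl ; π = π ; section = punchIn v
  ; π-section = π-section ; section≢v = punchInᵢ≢i v
  ; π-u≡v = π-u≡v ; fibre = fibre }
  where
  v≢u : v ≢ u
  v≢u = ≢-sym u≢v
  π : Fin (suc n) → Fin n
  π x with v ≟ x
  ... | yes _   = punchOut v≢u
  ... | no  v≢x = punchOut v≢x
  π-section : ∀ a → π (punchIn v a) ≡ a
  π-section a with v ≟ punchIn v a
  ... | yes e = ⊥-elim (punchInᵢ≢i v a (sym e))
  ... | no  _ = trans (punchOut-cong v refl) (punchOut-punchIn v)
  π-u≡v : π u ≡ π v
  π-u≡v with v ≟ u | v ≟ v
  ... | yes e | _     = ⊥-elim (v≢u e)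
  ... | no _  | yes _ = punchOut-cong v refl
  ... | no _  | no e  = ⊥-elim (e refl)
  fibre : ∀ x y → π x ≡ π y → x ≡ y ⊎ (x ≡ u × y ≡ v) ⊎ (x ≡ v × y ≡ u)
  fibre x y e with v ≟ x | v ≟ y
  ... | yes refl | yes refl = inj₁ refl
  ... | yes refl | no v≢y   = inj₂ (inj₂ (refl , sym (punchOut-injective v≢u v≢y e)))
  ... | no v≢x   | yes refl = inj₂ (inj₁ (punchOut-injective v≢x v≢u e , refl))
  ... | no v≢x   | no v≢y   = inj₁ (punchOut-injective v≢x v≢y e)

-- Recursion on the number of points: after its last visit to `x`, a walk lives on the `n` other
-- points. Decidability serves to extract an actual walk from a doubly negated one.
star? : ∀ {n} {R : Rel (Fin n) _} → (∀ x y → Dec (R x y)) → ∀ x y → Dec (Star R x y)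
star? {suc n} {R} R? x y with x ≟ y
... | yes refl = yes ε
... | no x≢y = map′ from to (any? λ w → R? x (punchIn x w) ×-dec star? R′? w (punchOut x≢y))
  where
  R′ : Rel (Fin n) _
  R′ a b = R (punchIn x a) (punchIn x b)
  R′? : ∀ a b → Dec (R′ a b)
  R′? a b = R? (punchIn x a) (punchIn x b)
  Via : Set
  Via = ∃ λ w → R x (punchIn x w) × Star R′ w (punchOut x≢y)
  from : Via → Star R x y
  from (w , r , p) = r ◅ subst (Star R _) (punchIn-punchOut x≢y) (gmap (punchIn x) id p)
  -- A walk to y either avoids x or has a last visit to x.
  split : ∀ {z} → Star R z y → (∃ λ w → z ≡ punchIn x w × Star R′ w (punchOut x≢y)) ⊎ Via
  split ε = inj₁ (punchOut x≢y , sym (punchIn-punchOut x≢y) , ε)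
  split {z} (r ◅ p) with split p
  ... | inj₂ via = inj₂ via
  ... | inj₁ (w , refl , q) with x ≟ z
  ...   | yes refl = inj₂ (w , r , q)
  ...   | no x≢z   = inj₁ (punchOut x≢z , sym (punchIn-punchOut x≢z) ,
                           subst (λ a → R a (punchIn x w)) (sym (punchIn-punchOut x≢z)) r ◅ q)
  to : Star R x y → Via
  to p with split p
  ... | inj₁ (w , e , _) = ⊥-elim (punchInᵢ≢i x w (sym e))
  ... | inj₂ via         = via

-- Graphs

open Graph using (adj; symmetric; irreflexive)

Adj? : (G : Graph) → ∀ x y → Dec (Adj G x y)
Adj? G x y = T? (adj G x y)

spanned : (n : ℕ) {R : Rel (Fin n) 0ℓ} → (∀ x y → Dec (R x y)) →
          (∀ {x y} → R x y → R y x) → (∀ x → ¬ R x x) → Graph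
spanned n R? R-sym R-irrefl = record
  { order       = n
  ; adj         = λ x y → ⌊ R? x y ⌋
  ; symmetric   = λ {x} {y} e → fromWitness {a? = R? y x} (R-sym (toWitness {a? = R? x y} e))
  ; irreflexive = λ { {x} refl e → R-irrefl x (toWitness {a? = R? x x} e) }
  }

induced : (G : Graph) {P : Vertex G → Set} → Enumeration P → Graph
induced G E = record
  { order       = E.size
  ; adj         = λ x y → adj G (E.elem x) (E.elem y)
  ; symmetric   = symmetric G
  ; irreflexive = λ { refl → irreflexive G refl }
  }
  where module E = Enumeration E

Inside : (G : Graph) → (Vertex G → Set) → Rel (Vertex G) _
Inside G P x y = P x × P y × Adj G x y

Conn : (G : Graph) → (Vertex G → Set) → Rel (Vertex G) _
Conn G P = Star (Inside G P)

conn-sym : ∀ G {P x y} → Conn G P x y → Conn G P y x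
conn-sym G = Star.reverse λ (p , q , e) → q , p , symmetric G e

conn-⊆ : ∀ G {P Q : Vertex G → Set} → (∀ z → P z → Q z) → ∀ {x y} → Conn G P x y → Conn G Q x y
conn-⊆ G P⊆Q = Star.map λ (p , q , e) → P⊆Q _ p , P⊆Q _ q , e

-- The steps are kept as a relation on indices, not as edges of an induced graph, because the walk
-- is used in a graph from which edges have been discarded.
restrict : ∀ G {P Q : Vertex G → Set} (E : Enumeration P) → (∀ z → Q z → P z) →
           ∀ {x y} i j → elem E i ≡ x → elem E j ≡ y → Conn G Q x y →
           Star (λ a b → Inside G Q (elem E a) (elem E b)) i j
restrict G E Q⊆P i j refl e ε = subst (Star _ i) (Enumeration.injective E (sym e)) ε
restrict G {Q = Q} E Q⊆P i j refl refl ((p , q , a) ◅ c) =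
  (p , subst Q (sym k≡) q , subst (Adj G _) (sym k≡) a) ◅ restrict G E Q⊆P k j k≡ refl c
  where
  k  = index E _ (Q⊆P _ q)
  k≡ = elem-index E _ (Q⊆P _ q)

module Contraction (G : Graph) {u v : Vertex G} (u≢v : u ≢ v) where
  open Merge (merge u≢v) public

  private
    R : Rel (Fin size) _
    R a b = a ≢ b × ∃₂ λ x y → π x ≡ a × π y ≡ b × Adj G x y
    R? : ∀ a b → Dec (R a b)
    R? a b = ¬? (a ≟ b) ×-dec any? λ x → any? λ y → (π x ≟ a) ×-dec (π y ≟ b) ×-dec Adj? G x y

  contracted : Graph
  contracted = spanned size R?
    (λ (a≢b , x , y , p , q , e) → ≢-sym a≢b , y , x , q , p , symmetric G e)
    (λ _ (a≢a , _) → a≢a refl)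

  adjacency : ∀ a b → Adj contracted a b ⇔ (a ≢ b × ∃₂ λ x y → π x ≡ a × π y ≡ b × Adj G x y)
  adjacency a b = mk⇔ (toWitness {a? = R? a b}) (fromWitness {a? = R? a b})

  section-π : ∀ x → section (π x) ≡ x ⊎ (section (π x) ≡ u × x ≡ v)
  section-π x with fibre (section (π x)) x (π-section (π x))
  ... | inj₁ e               = inj₁ e
  ... | inj₂ (inj₁ e)        = inj₂ e
  ... | inj₂ (inj₂ (e , _))  = ⊥-elim (section≢v _ e)

  π-injective : ∀ {x y} → x ≢ v → y ≢ v → π x ≡ π y → x ≡ y
  π-injective x≢v y≢v e with fibre _ _ e
  ... | inj₁ x≡y              = x≡y
  ... | inj₂ (inj₁ (_ , y≡v)) = ⊥-elim (y≢v y≡v)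
  ... | inj₂ (inj₂ (x≡v , _)) = ⊥-elim (x≢v x≡v)

  respects : ∀ {A : Set} (f : Vertex G → A) → f u ≡ f v → ∀ x → f (section (π x)) ≡ f x
  respects f fu≡fv x with section-π x
  ... | inj₁ e          = cong f e
  ... | inj₂ (e , refl) = trans (cong f e) fu≡fv

  contracts : Adj G u v → G ContractsTo contracted
  contracts uv = record
    { u = u ; v = v ; edge = uv ; π = π
    ; surjective = λ a → section a , λ { refl → π-section a }
    ; fibres = λ x y → mk⇔ (fibre x y) λ
        { (inj₁ refl) → refl
        ; (inj₂ (inj₁ (refl , refl))) → π-u≡v
        ; (inj₂ (inj₂ (refl , refl))) → sym π-u≡v }
    ; adjacency = adjacency }

  push-adj : ∀ {x y} → π x ≢ π y → Adj G x y → Adj contracted (π x) (π y)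
  push-adj neq e = Equivalence.from (adjacency _ _) (neq , _ , _ , refl , refl , e)

  -- Steps inside a fibre of `π` vanish; all others become edges of the contracted graph.
  push-conn : ∀ {P : Vertex G → Set} {Q : Fin size → Set} → (∀ z → P z → Q (π z)) →
              ∀ {x y} → Conn G P x y → Conn contracted Q (π x) (π y)
  push-conn P⇒Q ε = ε
  push-conn {Q = Q} P⇒Q {x} {y} (_◅_ {j = w} (p , q , e) c) with π x ≟ π w
  ... | yes eq = subst (λ a → Conn contracted Q a (π y)) (sym eq) (push-conn P⇒Q c)
  ... | no neq = (P⇒Q x p , P⇒Q w q , push-adj neq e) ◅ push-conn P⇒Q c

-- Bunches and models

-- Branch sets: nonempty connected vertex sets indexed by `A`. They are disjoint because `label` is
-- a function, and vertices labelled `nothing` belong to none of them.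
record Bunch (G : Graph) (A : Set) : Set where
  field
    label      : Vertex G → Maybe A
    root       : A → Vertex G
    label-root : ∀ a → label (root a) ≡ just a
    conn       : ∀ {x a} → label x ≡ just a → Conn G (λ y → label y ≡ just a) x (root a)

  Class : A → Vertex G → Set
  Class a x = label x ≡ just a

  class-conn : ∀ {x y a} → Class a x → Class a y → Conn G (Class a) x y
  class-conn p q = conn p ◅◅ conn-sym G (conn q)

  root-injective : ∀ {a b} → root a ≡ root b → a ≡ b
  root-injective {a} {b} e =
    just-injective (trans (sym (label-root a)) (trans (cong label e) (label-root b)))

Touching : ∀ {G A} → Bunch G A → A → A → Set
Touching {G} B a b = ∃₂ λ x y → Bunch.Class B a x × Bunch.Class B b y × Adj G x y

-- A minor model. Unlike contraction sequences, models compose directly and can be assembled from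
-- pieces of `G`.
record Model (H G : Graph) : Set where
  field
    bunch : Bunch G (Vertex H)
    edges : ∀ a b → Adj H a b → Touching bunch a b
  open Bunch bunch public

-- Each edge of the walk in `H` is replaced by an edge between two branch sets, and each of its
-- vertices by a walk inside the branch set.
lift-conn : ∀ {H G} (M : Model H G) {Q : Vertex H → Set} {R : Vertex G → Set} →
            (∀ x h → Model.Class M h x → Q h → R x) →
            ∀ {h h′ x y} → Q h → Conn H Q h h′ → Model.Class M h x → Model.Class M h′ y → Conn G R x y
lift-conn {G = G} M Q⊆R q ε p p′ = conn-⊆ G (λ z c → Q⊆R z _ c q) (Model.class-conn M p p′)
lift-conn {G = G} M {Q} {R} Q⊆R q ((_ , q₁ , e) ◅ c) p p′ =
  let x , y , cx , cy , a = Model.edges M _ _ e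
  in conn-⊆ G (λ z c → Q⊆R z _ c q) (Model.class-conn M p cx) ◅◅
     (Q⊆R _ _ cx q , Q⊆R _ _ cy q₁ , a) ◅ lift-conn M {Q} {R} Q⊆R q₁ c cy p′

>>=-just : ∀ {A B : Set} (m : Maybe A) {f : A → Maybe B} {b} →
           (m Maybe.>>= f) ≡ just b → ∃ λ a → m ≡ just a × f a ≡ just b
>>=-just (just a) e = a , refl , e

just->>= : ∀ {A B : Set} {m : Maybe A} (f : A → Maybe B) {a b} →
           m ≡ just a → f a ≡ just b → (m Maybe.>>= f) ≡ just b
just->>= f refl e = e

compose : ∀ {H G A} → Model H G → Bunch H A → Bunch G A
compose M B = record
  { label      = λ x → M.label x Maybe.>>= B.label
  ; root       = M.root ∘ B.root
  ; label-root = λ a → just->>= B.label (M.label-root _) (B.label-root a)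
  ; conn       = λ {x} p → let h , q , r = >>=-just (M.label x) p in
      lift-conn M (λ y _ c d → just->>= B.label c d) r (B.conn r) q (M.label-root _)
  }
  where
  module M = Model M
  module B = Bunch B

compose-touching : ∀ {H G A} (M : Model H G) (B : Bunch H A) {a b} →
                   Touching B a b → Touching (compose M B) a b
compose-touching M B (h , h′ , p , p′ , e) =
  let x , y , q , q′ , e′ = Model.edges M h h′ e
  in x , y , just->>= (Bunch.label B) q p , just->>= (Bunch.label B) q′ p′ , e′

model-trans : ∀ {F H G} → Model H G → Model F H → Model F G
model-trans M N = record
  { bunch = compose M (Model.bunch N)
  ; edges = λ a b e → compose-touching M (Model.bunch N) (Model.edges N a b e)
  }

model-refl : ∀ {G} → Model G G
model-refl = record
  { bunch = record { label = just ; root = id ; label-root = λ _ → refl ; conn = λ { refl → ε } }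
  ; edges = λ a b e → a , b , refl , refl , e
  }

contraction-model : ∀ {G H} → G ContractsTo H → Model H G
contraction-model {G} {H} C = record
  { bunch = record
    { label      = just ∘ π
    ; root       = proj₁ ∘ surjective
    ; label-root = λ a → cong just (proj₂ (surjective a) refl)
    ; conn       = λ {x} p → go x _ (trans p (cong just (sym (proj₂ (surjective _) refl)))) p
    }
  ; edges = λ a b e → let _ , x , y , p , q , e′ = Equivalence.to (adjacency a b) e
                      in x , y , cong just p , cong just q , e′
  }
  where
  open _ContractsTo_ C
  go : ∀ x y {a} → just (π x) ≡ just (π y) → just (π x) ≡ a → Conn G (λ z → just (π z) ≡ a) x y
  go x y e refl with Equivalence.to (fibres x y) (just-injective e)
  ... | inj₁ refl                 = ε
  ... | inj₂ (inj₁ (refl , refl)) = (refl , sym e , edge) ◅ ε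
  ... | inj₂ (inj₂ (refl , refl)) = (refl , sym e , symmetric G edge) ◅ ε

singletons : ∀ G {n} (r : Fin n → Vertex G) → Injective _≡_ _≡_ r → Bunch G (Fin n)
singletons G r r-inj = record
  { label      = preimage r
  ; root       = r
  ; label-root = preimage-complete r-inj
  ; conn       = λ p → subst (λ y → Conn G _ y _) (preimage-sound r p) ε
  }

subgraph-model : ∀ {S G} → S IsSubgraphOf G → Model S G
subgraph-model {G = G} S⊆G = record
  { bunch = singletons G embed injective
  ; edges = λ a b e → embed a , embed b , preimage-complete injective a ,
                      preimage-complete injective b , preserves e
  }
  where open _IsSubgraphOf_ S⊆G

minor⇒model : ∀ {H G} → H IsMinorOf G → Model H G
minor⇒model (S , S⊆G , cs) = model-trans (subgraph-model S⊆G) (go cs)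
  where
  go : ∀ {S H} → Star _ContractsTo_ S H → Model H S
  go ε        = model-refl
  go (c ◅ cs) = model-trans (contraction-model c) (go cs)

-- Minors from models

record Quotient (S H : Graph) : Set where
  field
    π         : Vertex S → Vertex H
    section   : Vertex H → Vertex S
    π-section : ∀ a → π (section a) ≡ a
    conn      : ∀ x y → π x ≡ π y → Conn S (λ z → π z ≡ π y) x y
    adjacency : ∀ a b → Adj H a b ⇔ (a ≢ b × ∃₂ λ x y → π x ≡ a × π y ≡ b × Adj S x y)

  Collapses : Set
  Collapses = ∃₂ λ x y → x ≢ y × π x ≡ π y

  collapses? : Dec Collapses
  collapses? = any? λ x → any? λ y → ¬? (x ≟ y) ×-dec (π x ≟ π y)

-- A quotient has connected fibres, so a fibre with two vertices contains an edge. Contracting it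
-- leaves a quotient of a smaller graph, and induction on the order applies.
quotient-contracts : ∀ n {S H} → order S < n → (Q : Quotient S H) → Quotient.Collapses Q →
                     Star _ContractsTo_ S H
quotient-contracts (suc n) {S} {H} (s≤s S≤n) Q (x , y , x≢y , πx≡πy) = go x≢y (Q.conn x y πx≡πy)
  where
  module Q = Quotient Q
  module _ {u v} (u≢v : u ≢ v) (uv : Adj S u v) (πu≡πv : Q.π u ≡ Q.π v) where
    module C = Contraction S u≢v
    lower : Vertex C.contracted → Vertex H
    lower = Q.π ∘ C.section
    lower-π : ∀ x → lower (C.π x) ≡ Q.π x
    lower-π = C.respects Q.π πu≡πv
    lowered : Quotient C.contracted H
    lowered = record
      { π         = lower
      ; section   = C.π ∘ Q.section
      ; π-section = λ a → trans (lower-π (Q.section a)) (Q.π-section a)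
      ; conn      = λ a b e → subst₂ (Conn C.contracted _) (C.π-section a) (C.π-section b)
                                (C.push-conn (λ z p → trans (lower-π z) p)
                                  (Q.conn (C.section a) (C.section b) e))
      ; adjacency = λ a b → mk⇔
          (λ e → let a≢b , x , y , p , q , e′ = Equivalence.to (Q.adjacency a b) e in
             a≢b , C.π x , C.π y , trans (lower-π x) p , trans (lower-π y) q ,
             C.push-adj (λ eq → a≢b (trans (trans (sym p) (trans (sym (lower-π x)) (cong lower eq)))
                                           (trans (lower-π y) q))) e′)
          (λ (a≢b , c , d , p , q , e) →
             let _ , x , y , p′ , q′ , e′ = Equivalence.to (C.adjacency c d) e in
             Equivalence.from (Q.adjacency a b)
               (a≢b , x , y , trans (sym (lower-π x)) (trans (cong lower p′) p)
                    , trans (sym (lower-π y)) (trans (cong lower q′) q) , e′))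
      }
    conclude : Dec (Quotient.Collapses lowered) → Star _ContractsTo_ S H
    conclude (yes cl) = C.contracts uv ◅ quotient-contracts n (<-≤-trans C.size< S≤n) lowered cl
    -- Nothing is left to collapse, so `π` itself is the contraction of `uv`. Using `H` as the
    -- target avoids ending at a mere isomorphic copy of it.
    conclude (no ¬cl) =
      record
        { u = u ; v = v ; edge = uv ; π = Q.π
        ; surjective = λ a → Q.section a , λ { refl → Q.π-section a }
        ; fibres = λ x y → mk⇔
            (λ e → C.fibre x y (decidable-stable (C.π x ≟ C.π y) λ neq →
               ¬cl (_ , _ , neq , trans (lower-π x) (trans e (sym (lower-π y)))))) λ
            { (inj₁ refl) → refl
            ; (inj₂ (inj₁ (refl , refl))) → πu≡πv
            ; (inj₂ (inj₂ (refl , refl))) → sym πu≡πv }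
        ; adjacency = Q.adjacency }
      ◅ ε
    contract : Star _ContractsTo_ S H
    contract = conclude (Quotient.collapses? lowered)
  go : ∀ {a b c} → a ≢ b → Conn S (λ z → Q.π z ≡ c) a b → Star _ContractsTo_ S H
  go a≢b ε = ⊥-elim (a≢b refl)
  go a≢b ((p , q , e) ◅ _) = contract (λ { refl → irreflexive S refl e }) e (trans p (sym q))

-- The labelled vertices, with the edges that `H` allows, form a subgraph whose quotient by the
-- labels is `H`.
model⇒minor : ∀ {H G} → Model H G → H IsMinorOf G
model⇒minor {H} {G} M = conclude Q.collapses?
  where
  module M = Model M
  Labelled : Vertex G → Set
  Labelled x = ∃ λ h → M.Class h x
  labelled? : ∀ x → Dec (Labelled x)
  labelled? x with M.label x
  ... | just h  = yes (h , refl)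
  ... | nothing = no λ ()
  E : Enumeration Labelled
  E = enumerate labelled?
  module E = Enumeration E
  π : Fin E.size → Vertex H
  π i = proj₁ (E.sound i)
  class : ∀ i → M.Class (π i) (E.elem i)
  class i = proj₂ (E.sound i)
  π-unique : ∀ {i h} → M.Class h (E.elem i) → π i ≡ h
  π-unique c = just-injective (trans (sym (class _)) c)
  section : Vertex H → Fin E.size
  section h = E.index (M.root h) (h , M.label-root h)
  elem-section : ∀ h → E.elem (section h) ≡ M.root h
  elem-section h = E.elem-index _ _
  π-section : ∀ h → π (section h) ≡ h
  π-section h = π-unique (subst (M.Class h) (sym (elem-section h)) (M.label-root h))
  -- Edges of G between classes that are not adjacent in H are discarded.
  R : Rel (Fin E.size) _
  R i j = Adj G (E.elem i) (E.elem j) × (π i ≡ π j ⊎ Adj H (π i) (π j))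
  S : Graph
  S = spanned E.size {R} (λ i j → Adj? G _ _ ×-dec ((π i ≟ π j) ⊎-dec Adj? H (π i) (π j)))
    (λ (e , f) → symmetric G e , [ inj₁ ∘ sym , inj₂ ∘ symmetric H ]′ f)
    (λ i (e , _) → irreflexive G refl e)
  S-adj : ∀ {i j} → R i j → Adj S i j
  S-adj = fromWitness
  S-adj⁻ : ∀ {i j} → Adj S i j → R i j
  S-adj⁻ = toWitness
  S⊆G : S IsSubgraphOf G
  S⊆G = record
    { embed = E.elem ; injective = E.injective ; preserves = λ {i} {j} e → proj₁ (S-adj⁻ {i} {j} e) }
  Q : Quotient S H
  Q = record
    { π = π ; section = section ; π-section = π-section
    ; conn = λ i j e → Star.map
        (λ {a} {b} (p , q , ab) → π-unique p , π-unique q ,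
           S-adj {a} {b} (ab , inj₁ (trans (π-unique p) (sym (π-unique q)))))
        (restrict G E (λ z p → π j , p) i j refl refl
          (M.class-conn (subst (λ h → M.Class h (E.elem i)) e (class i)) (class j)))
    ; adjacency = λ a b → mk⇔
        (λ e → let x , y , p , q , xy = M.edges a b e
                   px = subst (M.Class a) (sym (E.elem-index x (a , p))) p
                   py = subst (M.Class b) (sym (E.elem-index y (b , q))) q in
           (λ { refl → irreflexive H refl e }) ,
           E.index x (a , p) , E.index y (b , q) , π-unique px , π-unique py ,
           S-adj (subst₂ (Adj G) (sym (E.elem-index _ _)) (sym (E.elem-index _ _)) xy ,
                  inj₂ (subst₂ (Adj H) (sym (π-unique px)) (sym (π-unique py)) e)))
        (λ { (a≢b , i , j , refl , refl , e) →
           [ (λ eq → ⊥-elim (a≢b eq)) , id ]′ (proj₂ (S-adj⁻ {i} {j} e)) })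
    }
  module Q = Quotient Q
  conclude : Dec Q.Collapses → H IsMinorOf G
  conclude (yes cl) = S , S⊆G , quotient-contracts _ ≤-refl Q cl
  -- All branch sets are single vertices here: `H` embeds into `G` by its roots and no contraction
  -- takes place.
  conclude (no ¬cl) = H , record
    { embed = M.root ; injective = M.root-injective
    ; preserves = λ {a} {b} e → let _ , i , j , p , q , ij = Equivalence.to (Q.adjacency a b) e in
        subst₂ (Adj G) (only i p) (only j q) (proj₁ (S-adj⁻ {i} {j} ij)) } , ε
    where
    only : ∀ i {h} → π i ≡ h → E.elem i ≡ M.root h
    only i {h} p = trans (cong E.elem (decidable-stable (i ≟ section h) λ neq →
      ¬cl (i , section h , neq , trans p (sym (π-section h))))) (elem-section h)

-- Separations

record Separation (H : Graph) (X F : Vertex H → Set) : Set where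
  field
    disjoint : ∀ {w} → X w → ¬ F w
    closed   : ∀ {v w} → F v → Adj H v w → F w ⊎ X w

Covers : ∀ {m} {V : Set} → (Fin m → V) → (V → Set) → Set
Covers y X = ∀ w → X w → ∃ λ i → w ≡ y i

-- Bounds the size of `X` by `m` without deciding `X`: the listed vertices may repeat or lie outside
-- `X`.
Covered : ∀ {V : Set} → ℕ → (V → Set) → Set
Covered {V} m X = ∃ λ (y : Fin m → V) → Covers y X

cover-without : ∀ {V : Set} {X : V → Set} {m} (y : Fin m → V) i →
                (∀ w → X w → ∃ λ j → i ≢ j × w ≡ y j) → ∃ λ n → n < m × Covered n X
cover-without {m = suc m} y i cov =
  m , ≤-refl , y ∘ punchIn i , λ w x → let j , i≢j , e = cov w x in
    punchOut i≢j , trans e (cong y (sym (punchIn-punchOut i≢j)))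

module MinimalCover {n m} {X : Fin n → Set} {y : Fin m → Fin n} (cov : Covers y X)
                    (minimal : ∀ n → n < m → ¬ Covered n X) where

  private
    needed : ∀ i → ¬ (∀ w → X w → ∃ λ j → i ≢ j × w ≡ y j)
    needed i h = let n , n<m , c = cover-without y i h in minimal n n<m c

  injective : Injective _≡_ _≡_ y
  injective {i} {j} e = decidable-stable (i ≟ j) λ i≢j → needed i λ w x → avoid i≢j (cov w x)
    where
    avoid : i ≢ j → ∀ {w} → (∃ λ k → w ≡ y k) → ∃ λ k → i ≢ k × w ≡ y k
    avoid i≢j (k , p) with i ≟ k
    ... | yes refl = j , i≢j , trans p e
    ... | no i≢k   = k , i≢k , p

  exact : ∀ i → ¬ ¬ X (y i)
  exact i ¬x = needed i λ w x → let k , p = cov w x in k , (λ { refl → ¬x (subst X p x) }) , p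

Lift : ∀ {n} {P : Fin n → Set} (E : Enumeration P) → (Fin (Enumeration.size E) → Set) → Fin n → Set
Lift E Q w = ∃ λ i → elem E i ≡ w × Q i

covered-lift : ∀ {n m} {P : Fin n → Set} (E : Enumeration P) {Q} → Covered m Q → Covered m (Lift E Q)
covered-lift E (y , cov) =
  elem E ∘ y , λ { w (i , refl , q) → let j , e = cov i q in j , cong (elem E) e }

lift-elem : ∀ {n} {P : Fin n → Set} (E : Enumeration P) {Q i} → Lift E Q (elem E i) → Q i
lift-elem E {Q} (j , e , q) = subst Q (Enumeration.injective E e) q

-- Blocks X F says that the part of H which the roots are to be linked to lies behind X: for Menger's
-- theorem this is Hits T, and for rooted cliques it is ContainsPiece β.
NoSmallSeparation : (H : Graph) (z : ℕ) → (Fin z → Vertex H) →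
                    ((Vertex H → Set) → (Vertex H → Set) → Set) → Set₁
NoSmallSeparation H z r Blocks = ∀ X F → Separation H X F → (∀ a → ¬ F (r a)) → Blocks X F →
                                 ∀ m → m < z → ¬ Covered m X

-- A separation of order exactly `z`. Its sets are decidable so that the graphs on its two sides can
-- be formed.
record Cut (H : Graph) (z : ℕ) (r : Fin z → Vertex H) : Set₁ where
  field
    X F         : Vertex H → Set
    X?          : ∀ w → Dec (X w)
    F?          : ∀ w → Dec (F w)
    separation  : Separation H X F
    roots∉F     : ∀ a → ¬ F (r a)
    y           : Fin z → Vertex H
    y-injective : Injective _≡_ _≡_ y
    y∈X         : ∀ i → X (y i)
    cover       : Covers y X
  open Separation separation public

-- The root outside `F` and `X` makes the far graph smaller than `H`. That `u` and `v` lie in `X`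
-- serves in Menger's theorem to show that `F` is nonempty.
CutThrough : (H : Graph) (z : ℕ) → (Fin z → Vertex H) → (u v : Vertex H) →
             ((Vertex H → Set) → (Vertex H → Set) → Set) → Set₁
CutThrough H z r u v Blocks =
  Σ (Cut H z r) λ K → let open Cut K in
    X u × X v × Blocks X F × ∃ λ a → ¬ F (r a) × ¬ X (r a)

-- If contracting uv creates a small separation, then pulling it back gives a separation of order
-- exactly z through both u and v.
contract-or-cut :
  ∀ {H z u v} (r : Fin z → Vertex H) (u≢v : u ≢ v) → Injective _≡_ _≡_ r → (∀ a → r a ≢ v) →
  let module C = Contraction H u≢v in
  ∀ {Blocks Blocks′} → NoSmallSeparation H z r Blocks →
  (∀ X F → Blocks′ X F → Blocks (X ∘ C.π) (F ∘ C.π)) →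
  ¬ ¬ (NoSmallSeparation C.contracted z (C.π ∘ r) Blocks′ ⊎ CutThrough H z r u v Blocks)
contract-or-cut {H} {z} {u} {v} r u≢v r-inj r≢v {Blocks} {Blocks′} noSmall pull = do
  no ¬ns ← ¬¬-excluded-middle
    where yes ns → return (inj₁ ns)
  λ k → ¬ns λ X′ F′ sep r∉F′ blk m m<z (y′ , cov′) → cut X′ F′ sep r∉F′ blk y′ cov′ m<z (k ∘ inj₂)
  where
  module C = Contraction H u≢v
  module _ X′ F′ (sep : Separation C.contracted X′ F′) (r∉F : ∀ a → ¬ F′ (C.π (r a)))
           (blk′ : Blocks′ X′ F′) {m} (y′ : Fin m → Vertex C.contracted) (cov′ : Covers y′ X′) where
    X F : Vertex H → Set
    X = X′ ∘ C.π
    F = F′ ∘ C.π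
    -- The section never takes the value `v`, so the pulled-back cover needs `v` as one extra
    -- element.
    y : Fin (suc m) → Vertex H
    y zero    = v
    y (suc i) = C.section (y′ i)
    cov : Covers y X
    cov w x with C.section-π w | cov′ (C.π w) x
    ... | inj₁ e       | i , p = suc i , trans (sym e) (cong C.section p)
    ... | inj₂ (_ , e) | _     = zero , e
    closed : ∀ {a b} → F a → Adj H a b → F b ⊎ X b
    closed {a} {b} f e with C.π a ≟ C.π b
    ... | yes p = inj₁ (subst F′ p f)
    ... | no ¬p = Separation.closed sep f (C.push-adj ¬p e)
    separation : Separation H X F
    separation = record { disjoint = Separation.disjoint sep ; closed = closed }
    cut : m < z → ¬ ¬ CutThrough H z r u v Blocks
    cut m<z with m≤n⇒m<n∨m≡n m<z
    ... | inj₁ 1+m<z = λ _ → noSmall X F separation r∉F (pull X′ F′ blk′) (suc m) 1+m<z (y , cov)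
    ... | inj₂ refl  = do
      let module Y = MinimalCover cov (noSmall X F separation r∉F (pull X′ F′ blk′))
      X? ← decide X
      F? ← decide F
      y∈X ← ¬¬-∀ Y.exact
      -- No root equals `v`, which is `y zero`. If all `z` roots were in `X`, they would therefore
      -- inject into `z` indices while missing one.
      let a , ¬x = ¬∀⟶∃¬ _ _ (X? ∘ r) λ h → n≮n _ (injective-avoiding⇒<
            {f = λ a → proj₁ (cov (r a) (h a))}
            (λ {a} {b} e → r-inj (trans (proj₂ (cov (r a) (h a)))
              (trans (cong y e) (sym (proj₂ (cov (r b) (h b)))))))
            zero (λ a e → r≢v a (trans (proj₂ (cov (r a) (h a))) (cong y (sym e)))))
          v∈X = y∈X zero
      return (record
        { X = X ; F = F ; X? = X? ; F? = F? ; separation = separation ; roots∉F = r∉F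
        ; y = y ; y-injective = Y.injective ; y∈X = y∈X ; cover = cov }
        , subst X′ (sym C.π-u≡v) v∈X , v∈X , pull X′ F′ blk′ , a , r∉F a , ¬x)

Rooted : ∀ {H z} → Bunch H (Fin z) → (Fin z → Vertex H) → Set
Rooted B r = ∀ a → Bunch.Class B a (r a)

-- Disjoint connected sets stand in for Menger's disjoint paths: each contains a walk from its root
-- to a target.
Linkage : (H : Graph) (z : ℕ) → (Fin z → Vertex H) → (Vertex H → Set) → Set
Linkage H z r T = Σ (Bunch H (Fin z)) λ B → Rooted B r × ∀ a → ∃ λ t → Bunch.Class B a t × T t

Hits : ∀ {V : Set} → (V → Set) → (V → Set) → (V → Set) → Set
Hits T X F = ∀ t → T t → F t ⊎ X t

-- The two sides of a cut, and joining bunches across it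

module Sides {H z r} (K : Cut H z r) where
  open Cut K public

  near : Enumeration (λ w → ¬ F w)
  near = enumerate (¬? ∘ F?)
  far : Enumeration (λ w → F w ⊎ X w)
  far = enumerate λ w → F? w ⊎-dec X? w
  module Near = Enumeration near
  module Far = Enumeration far
  nearGraph = induced H near
  farGraph  = induced H far

  nearRoot : Fin z → Vertex nearGraph
  nearRoot a = Near.index (r a) (roots∉F a)
  farRoot : Fin z → Vertex farGraph
  farRoot c = Far.index (y c) (inj₂ (y∈X c))

  nearTarget : Vertex nearGraph → Set
  nearTarget = X ∘ Near.elem

  elem-farRoot : ∀ c → Far.elem (farRoot c) ≡ y c
  elem-farRoot c = Far.elem-index _ _

  nearRoot-injective : Injective _≡_ _≡_ r → Injective _≡_ _≡_ nearRoot
  nearRoot-injective r-inj e = r-inj (Near.index-injective e)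

  farRoot-injective : Injective _≡_ _≡_ farRoot
  farRoot-injective e = y-injective (Far.index-injective e)

  -- If `X′` cuts `X` off from the roots in the near graph, with `F′` behind it, then in `H` it has
  -- all of `F` and `F′` behind it. `mono` says that what was blocked by `X` stays blocked.
  near-noSmallSeparation :
    ∀ {Blocks} → NoSmallSeparation H z r Blocks → Blocks X F →
    (∀ X′ F′ → (∀ w → F w → F′ w) → (∀ w → X w → F′ w ⊎ X′ w) → Blocks X F → Blocks X′ F′) →
    NoSmallSeparation nearGraph z nearRoot (Hits nearTarget)
  near-noSmallSeparation noSmall blk mono X′ F′ sep r∉F′ hits m m<z cov =
    noSmall (Lift near X′) F″
      (record { disjoint = λ { (i , refl , x) →
                  [ Near.sound i , Separation.disjoint sep x ∘ lift-elem near ]′ }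
              ; closed = λ { (inj₁ f) e → closed⁺ (closed f e)
                           ; {w = w} (inj₂ (i , refl , f)) e → closed′ f e (F? w) } })
      (λ a → [ roots∉F a , (λ (i , e , f) →
        r∉F′ a (subst F′ (Near.injective (trans e (sym (Near.elem-index _ _)))) f)) ]′)
      (mono (Lift near X′) F″ (λ _ → inj₁) (λ w x → closed⁺ (inj₂ x)) blk)
      m m<z (covered-lift near cov)
    where
    F″ : Vertex H → Set
    F″ w = F w ⊎ Lift near F′ w
    closed⁺ : ∀ {w} → F w ⊎ X w → F″ w ⊎ Lift near X′ w
    closed⁺ (inj₁ f) = inj₁ (inj₁ f)
    closed⁺ {w} (inj₂ x) with hits (Near.index w (disjoint x)) (subst X (sym (Near.elem-index _ _)) x)
    ... | inj₁ f′ = inj₁ (inj₂ (_ , Near.elem-index _ _ , f′))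
    ... | inj₂ x′ = inj₂ (_ , Near.elem-index _ _ , x′)
    closed′ : ∀ {i w} → F′ i → Adj H (Near.elem i) w → Dec (F w) → F″ w ⊎ Lift near X′ w
    closed′ f e (yes fw) = inj₁ (inj₁ fw)
    closed′ {i} f e (no ¬fw) =
      let e≡ = Near.elem-index _ ¬fw in
      [ (λ f → inj₁ (inj₂ (_ , e≡ , f))) , (λ x → inj₂ (_ , e≡ , x)) ]′
        (Separation.closed sep f (subst (Adj H (Near.elem i)) (sym e≡) e))

  -- The far roots list `X`, so a set `F′` avoiding them lies in `F`, and its neighbours in `H` stay
  -- on the far side. Such a separation of the far graph is thus one of `H`.
  far-noSmallSeparation :
    ∀ {Blocks Blocks′} → NoSmallSeparation H z r Blocks →
    (∀ X′ F′ → (∀ c → ¬ F′ (farRoot c)) → Blocks′ X′ F′ → Blocks (Lift far X′) (Lift far F′)) →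
    NoSmallSeparation farGraph z farRoot Blocks′
  far-noSmallSeparation noSmall push X′ F′ sep r∉F′ blk m m<z cov =
    noSmall (Lift far X′) (Lift far F′)
      (record { disjoint = λ { (i , refl , x) → Separation.disjoint sep x ∘ lift-elem far }
              ; closed = λ { (i , refl , f) e → closed′ f e (closed (in-F f) e) } })
      (λ a (i , e , f) → roots∉F a (subst F e (in-F f)))
      (push X′ F′ r∉F′ blk) m m<z (covered-lift far cov)
    where
    in-F : ∀ {i} → F′ i → F (Far.elem i)
    in-F {i} f with Far.sound i
    ... | inj₁ p = p
    ... | inj₂ x = let c , e = cover _ x in
      ⊥-elim (r∉F′ c (subst F′ (Far.injective (trans e (sym (elem-farRoot c)))) f))
    closed′ : ∀ {i w} → F′ i → Adj H (Far.elem i) w → F w ⊎ X w → Lift far F′ w ⊎ Lift far X′ w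
    closed′ {i} f e p =
      let e≡ = Far.elem-index _ p in
      [ (λ f → inj₁ (_ , e≡ , f)) , (λ x → inj₂ (_ , e≡ , x)) ]′
        (Separation.closed sep f (subst (Adj H (Far.elem i)) (sym e≡) e))

  -- A walk from the far side either stays there or meets X.
  trace : ∀ {Q : Vertex H → Set} {v w} i → Far.elem i ≡ v → F v → Conn H Q v w →
          (∃ λ c → Q (y c) × Conn farGraph (Q ∘ Far.elem) i (farRoot c)) ⊎
          (F w × ∀ j → Far.elem j ≡ w → Conn farGraph (Q ∘ Far.elem) i j)
  trace i e f ε = inj₂ (f , λ j e′ → subst (Conn farGraph _ i) (Far.injective (trans e (sym e′))) ε)
  trace {Q} i refl f (_◅_ {j = v} (p , q , e) c) = [ inside , exit ]′ (closed f e)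
    where
    step : ∀ j → Far.elem j ≡ v → Inside farGraph (Q ∘ Far.elem) i j
    step j e′ = p , subst Q (sym e′) q , subst (Adj H _) (sym e′) e
    exit : X v → _
    exit x = let d , v≡ = cover v x in
      inj₁ (d , subst Q v≡ q , step (farRoot d) (trans (elem-farRoot d) (sym v≡)) ◅ ε)
    inside : F v → _
    inside f′ = [ (λ (d , q′ , c′) → inj₁ (d , q′ , step k k≡ ◅ c′))
                , (λ (fw , c′) → inj₂ (fw , λ j e′ → step k k≡ ◅ c′ j e′)) ]′
                (trace k k≡ f′ c)
      where
      k  = Far.index v (inj₁ f′)
      k≡ = Far.elem-index v (inj₁ f′)

  -- The near linkage matches the roots with X; its classes are prolonged by the far ones.
  module Join (L : Linkage nearGraph z nearRoot nearTarget)
              (Φ : Bunch farGraph (Fin z)) (Φ-rooted : Rooted Φ farRoot) where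
    module N = Bunch (proj₁ L)
    module Φ = Bunch Φ

    target : Fin z → Vertex nearGraph
    target a = proj₁ (proj₂ (proj₂ L) a)
    target∈ : ∀ a → N.Class a (target a)
    target∈ a = proj₁ (proj₂ (proj₂ (proj₂ L) a))
    σ : Fin z → Fin z
    σ a = proj₁ (cover _ (proj₂ (proj₂ (proj₂ (proj₂ L) a))))
    elem-target : ∀ a → Near.elem (target a) ≡ y (σ a)
    elem-target a = proj₂ (cover _ (proj₂ (proj₂ (proj₂ (proj₂ L) a))))

    σ-injective : Injective _≡_ _≡_ σ
    σ-injective {a} {b} e = just-injective (trans (sym (target∈ a)) (trans (cong N.label
      (Near.injective (trans (elem-target a) (trans (cong y e) (sym (elem-target b)))))) (target∈ b)))

    -- Far classes are indexed by the vertices of `X`; the inverse of `σ` renames them after the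
    -- roots linked to those vertices.
    τ : Fin z → Fin z
    τ c = proj₁ (injective⇒surjective σ-injective c)
    στ : ∀ c → σ (τ c) ≡ c
    στ c = proj₂ (injective⇒surjective σ-injective c)
    τσ : ∀ a → τ (σ a) ≡ a
    τσ a = σ-injective (στ (σ a))

    label : Vertex H → Maybe (Fin z)
    label v with F? v
    ... | yes f = Maybe.map τ (Φ.label (Far.index v (inj₁ f)))
    ... | no ¬f = N.label (Near.index v ¬f)

    label-near : ∀ i {a} → N.Class a i → label (Near.elem i) ≡ just a
    label-near i p with F? (Near.elem i)
    ... | yes f = ⊥-elim (Near.sound i f)
    ... | no ¬f = trans (cong N.label (Near.index-elem i ¬f)) p

    label-y : ∀ c → label (y c) ≡ just (τ c)
    label-y c = subst (λ w → label w ≡ just (τ c)) (trans (elem-target (τ c)) (cong y (στ c)))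
                  (label-near _ (target∈ (τ c)))

    -- Vertices of `X` take their label from the near side. The two sides agree there because `Φ`
    -- puts `farRoot d` into class `d`.
    label-far : ∀ i {c} → Φ.Class c i → label (Far.elem i) ≡ just (τ c)
    label-far i {c} p with Far.sound i
    ... | inj₂ x = let d , e = cover _ x
                       i≡ = Far.injective (trans e (sym (elem-farRoot d)))
                       d≡c = just-injective (trans (sym (Φ-rooted d)) (trans (cong Φ.label (sym i≡)) p))
                   in trans (cong label e) (trans (label-y d) (cong (just ∘ τ) d≡c))
    ... | inj₁ f with F? (Far.elem i)
    ...   | yes f′ = cong (Maybe.map τ) (trans (cong Φ.label (Far.index-elem i (inj₁ f′))) p)
    ...   | no ¬f  = ⊥-elim (¬f f)

    label⁻ : ∀ v {a} → label v ≡ just a →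
             (∃ λ i → Far.elem i ≡ v × Φ.Class (σ a) i) ⊎ (∃ λ i → Near.elem i ≡ v × N.Class a i)
    label⁻ v p with F? v
    label⁻ v p | no ¬f = inj₂ (_ , Near.elem-index v ¬f , p)
    label⁻ v p | yes f with Φ.label (Far.index v (inj₁ f)) in q
    label⁻ v refl | yes f | just c =
      inj₁ (_ , Far.elem-index v (inj₁ f) , trans q (cong just (sym (στ c))))

    conn-near : ∀ {i a} → N.Class a i → Conn H (λ w → label w ≡ just a) (Near.elem i) (r a)
    conn-near {i} {a} p = subst (Conn H _ _) (Near.elem-index _ _)
      (gmap Near.elem (λ (p , q , e) → label-near _ p , label-near _ q , e)
        (N.class-conn p (proj₁ (proj₂ L) a)))

    conn-far : ∀ {i a} → Φ.Class (σ a) i → Conn H (λ w → label w ≡ just a) (Far.elem i) (r a)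
    conn-far {i} {a} p =
      subst (Conn H _ _) (trans (elem-farRoot (σ a)) (sym (elem-target a)))
        (gmap Far.elem (λ (p , q , e) → far-class p , far-class q , e)
          (Φ.class-conn p (Φ-rooted (σ a))))
      ◅◅ conn-near (target∈ a)
      where
      far-class : ∀ {j} → Φ.Class (σ a) j → label (Far.elem j) ≡ just a
      far-class q = trans (label-far _ q) (cong just (τσ a))

    joined : Bunch H (Fin z)
    joined = record
      { label      = label
      ; root       = r
      ; label-root = λ a → subst (λ w → label w ≡ just a) (Near.elem-index _ _)
                             (label-near _ (proj₁ (proj₂ L) a))
      ; conn       = λ {v} p → [ (λ { (i , refl , q) → conn-far q })
                               , (λ { (i , refl , q) → conn-near q }) ]′ (label⁻ v p)
      }

    joined-far : ∀ {i a} → Φ.Class (σ a) i → Bunch.Class joined a (Far.elem i)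
    joined-far p = trans (label-far _ p) (cong just (τσ _))

-- Menger's theorem

-- The edge to contract must spare the roots at `v`, so that they remain distinct, and must not join
-- two targets, so that a cut through it has something behind it. For a cut, the near side links the
-- roots to `X`, the far side links `X` to `T`, and both graphs are smaller.
menger : ∀ n H → order H < n → ∀ {z} (r : Fin z → Vertex H) → Injective _≡_ _≡_ r →
         (T : Vertex H → Set) → NoSmallSeparation H z r (Hits T) → ¬ ¬ Linkage H z r T
menger (suc n) H (s≤s H≤n) {z} r r-inj T noSmall = do
  yes (u , v , e , r≢v , ¬Tuv) ← ¬¬-excluded-middle
    {A = ∃₂ λ u v → Adj H u v × (∀ a → r a ≢ v) × ¬ (T u × T v)}
    where no ¬edge → do
            T-root ← ¬¬-∀ (base ¬edge)
            return (singletons H r r-inj , preimage-complete r-inj ,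
                    λ a → r a , preimage-complete r-inj a , T-root a)
  let u≢v = λ { refl → irreflexive H refl e }
      module C = Contraction H u≢v
  inj₂ (K , u∈X , v∈X , T⊆ , a , a∉F , a∉X) ←
    contract-or-cut r u≢v r-inj r≢v {Blocks′ = Hits (λ c → ∃ λ x → C.π x ≡ c × T x)} noSmall
      (λ X F h t Tt → h (C.π t) (t , refl , Tt))
    where inj₁ noSmall′ → do
            B , B-rooted , hits ← menger n C.contracted (<-≤-trans C.size< H≤n) (C.π ∘ r)
              (λ p → r-inj (C.π-injective (r≢v _) (r≢v _) p))
              _ noSmall′
            return (compose (contraction-model (C.contracts e)) B , B-rooted ,
                    λ a → let _ , q , t , πt≡ , Tt = hits a in
                      t , trans (cong (Bunch.label B) πt≡) q , Tt)
  let open Sides K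
  f , Ff ← far-nonempty K u∈X v∈X ¬Tuv T⊆
  L ← menger n nearGraph (<-≤-trans (Near.size< f λ ¬f → ¬f Ff) H≤n)
        nearRoot (nearRoot-injective r-inj) nearTarget
        (near-noSmallSeparation noSmall T⊆ λ X′ F′ F⊆ X⊆ h t Tt → [ inj₁ ∘ F⊆ t , X⊆ t ]′ (h t Tt))
  Φ , Φ-rooted , hits ← menger n farGraph (<-≤-trans (Far.size< (r a) [ a∉F , a∉X ]′) H≤n)
        farRoot farRoot-injective (T ∘ Far.elem)
        (far-noSmallSeparation noSmall λ X′ F′ _ h t Tt →
          let p = T⊆ t Tt ; e≡ = Far.elem-index t p in
          [ (λ f → inj₁ (_ , e≡ , f)) , (λ x → inj₂ (_ , e≡ , x)) ]′ (h _ (subst T (sym e≡) Tt)))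
  let open Join L Φ Φ-rooted
  return (joined , Bunch.label-root joined , λ a →
    let t , p , Tt = hits (σ a) in Far.elem t , joined-far p , Tt)
  where
  -- If `F` were empty, `X` would contain all of `T`. As `u` or `v` is in `X` but not in `T`,
  -- dropping it would leave a separation that is too small.
  far-nonempty : ∀ {u v} (K : Cut H z r) → let open Cut K in
                 X u → X v → ¬ (T u × T v) → Hits T X F → ¬ ¬ ∃ F
  far-nonempty {u} {v} K u∈X v∈X ¬Tuv T⊆ = do
    no ∄F ← ¬¬-excluded-middle {A = ∃ F}
      where yes p → return p
    w , w∈X , ¬Tw ← outside
    let i , w≡ = cover w w∈X
        m , m<z , cov = cover-without {X = λ x → X x × x ≢ w} y i λ x (x∈X , x≢w) →
          let j , x≡ = cover x x∈X in
          j , (λ i≡j → x≢w (trans x≡ (trans (cong y (sym i≡j)) (sym w≡)))) , x≡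
    λ _ → noSmall (λ x → X x × x ≢ w) F
      (record { disjoint = disjoint ∘ proj₁ ; closed = λ f _ → ⊥-elim (∄F (_ , f)) })
      roots∉F (λ t Tt → [ inj₁ , (λ x → inj₂ (x , λ { refl → ¬Tw Tt })) ]′ (T⊆ t Tt)) m m<z cov
    where
    open Cut K
    outside : ¬ ¬ ∃ λ w → X w × ¬ T w
    outside = do
      no ¬Tu ← ¬¬-excluded-middle {A = T u}
        where yes Tu → return (v , v∈X , λ Tv → ¬Tuv (Tu , Tv))
      return (u , u∈X , ¬Tu)
  -- If r a were not a target, the other roots would separate all roots from T.
  base : ¬ (∃₂ λ u v → Adj H u v × (∀ a → r a ≢ v) × ¬ (T u × T v)) → ∀ a → ¬ ¬ T (r a)
  base ¬edge a ¬Ta =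
    noSmall X F
      (record { disjoint = λ { (b , _ , refl) f → f b refl } ; closed = closed })
      (λ b f → f b refl) (λ t Tt → classify t λ { refl → ¬Ta Tt })
      _ (proj₁ (proj₂ cov)) (proj₂ (proj₂ cov))
    where
    X F : Vertex H → Set
    X w = ∃ λ b → a ≢ b × w ≡ r b
    F w = ∀ b → r b ≢ w
    cov = cover-without {X = X} r a λ _ x → x
    classify : ∀ w → w ≢ r a → F w ⊎ X w
    classify w w≢ with any? (λ b → r b ≟ w)
    ... | yes (b , refl) = inj₂ (b , (λ { refl → w≢ refl }) , refl)
    ... | no ¬p          = inj₁ λ b e → ¬p (b , e)
    closed : ∀ {v w} → F v → Adj H v w → F w ⊎ X w
    -- A neighbour of `F` cannot be `r a`: the edge from the non-target `r a` to the non-root `v`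
    -- would still be contractible.
    closed {v} f e = classify _ λ { refl → ¬edge (r a , v , symmetric H e , f , ¬Ta ∘ proj₁) }

-- Rooted clique models

-- Fragments of a clique model: a piece that meets the roots need not be connected, but each of
-- its components contains a root.  This form survives passing to the far side of a separation.
record Fragments (H : Graph) {z p} (r : Fin z → Vertex H) (β : Vertex H → Maybe (Fin p)) : Set where
  Piece : Fin p → Vertex H → Set
  Piece i x = β x ≡ just i

  Free : Fin p → Set
  Free i = ∀ a → ¬ Piece i (r a)

  field
    conn : ∀ i x y → Piece i x → Piece i y →
           Conn H (Piece i) x y ⊎ (∃ λ a → Piece i (r a) × Conn H (Piece i) x (r a))
    meet : ∀ i j → i ≢ j → Free i → ∃₂ λ x y → Piece i x × Piece j y × Adj H x y

ContainsPiece : ∀ {V : Set} {p} → (V → Maybe (Fin p)) → (V → Set) → (V → Set) → Set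
ContainsPiece β X F = ∃ λ i → ∀ x → β x ≡ just i → F x

RootedClique : (H : Graph) (z : ℕ) → (Fin z → Vertex H) → Set
RootedClique H z r = Σ (Bunch H (Fin z)) λ B → Rooted B r × ∀ a b → a ≢ b → Touching B a b

module FarFragments {H z p} {r : Fin z → Vertex H} {β : Vertex H → Maybe (Fin p)}
                    (K : Cut H z r) (fragments : Fragments H r β)
                    (contains : ContainsPiece β (Cut.X K) (Cut.F K)) where
  open Sides K
  open Fragments fragments

  private
    Piece′ : Fin p → Vertex farGraph → Set
    Piece′ i = Piece i ∘ Far.elem
    i₀ = proj₁ contains
    i₀⊆F = proj₂ contains
    i₀-free : Free i₀
    i₀-free a q = roots∉F a (i₀⊆F _ q)
    Unmet : Fin p → Set
    Unmet i = ∀ c → ¬ Piece i (y c)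

  -- Piece `i₀` lies in `F` and touches piece `i`, which misses `X`, so `i` has a vertex in `F`.
  -- Walks in the piece from there cannot cross `X`; they reach every other vertex, since the
  -- alternative is a walk to a root, and roots are outside `F`.
  unmet⇒⊆F : ∀ {i} → Unmet i → ∀ x → Piece i x → F x
  unmet⇒⊆F {i} u x q with i₀ ≟ i
  ... | yes refl = i₀⊆F x q
  ... | no i₀≢i with meet i₀ i i₀≢i i₀-free
  ...   | v , w , v∈ , w∈ , e with closed (i₀⊆F v v∈) e
  ...     | inj₂ w∈X = let c , w≡ = cover w w∈X in ⊥-elim (u c (subst (Piece i) w≡ w∈))
  ...     | inj₁ w∈F with conn i w x w∈ q
  ...       | inj₁ c with trace _ (Far.elem-index w (inj₁ w∈F)) w∈F c
  ...         | inj₁ (d , d∈ , _) = ⊥-elim (u d d∈)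
  ...         | inj₂ (x∈F , _)    = x∈F
  unmet⇒⊆F {i} u x q | no _ | _ | inj₁ w∈F | inj₂ (a , _ , c)
    with trace _ (Far.elem-index _ (inj₁ w∈F)) w∈F c
  ... | inj₁ (d , d∈ , _) = ⊥-elim (u d d∈)
  ... | inj₂ (a∈F , _)    = ⊥-elim (roots∉F a a∈F)

  unmet⇒free : ∀ {i} → Unmet i → Free i
  unmet⇒free u a q = roots∉F a (unmet⇒⊆F u _ q)

  -- A walk in a piece either stays on the far side or reaches `X`, whose vertices are the new
  -- roots. A piece free of these lies in `F`, so its edges to other pieces survive.
  farFragments : Fragments farGraph farRoot (β ∘ Far.elem)
  farFragments = record { conn = conn′ ; meet = meet′ }
    where
    at-root : ∀ {i c} → Piece i (y c) → Piece′ i (farRoot c)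
    at-root {i} {c} = subst (Piece i) (sym (elem-farRoot c))
    unmet : ∀ {i} → (∀ c → ¬ Piece′ i (farRoot c)) → Unmet i
    unmet h c q = h c (at-root q)
    conn′ : ∀ i x y → Piece′ i x → Piece′ i y →
            Conn farGraph (Piece′ i) x y ⊎
            (∃ λ c → Piece′ i (farRoot c) × Conn farGraph (Piece′ i) x (farRoot c))
    conn′ i x y p q with Far.sound x
    ... | inj₂ x∈X = let c , x≡ = cover _ x∈X
                         x≡root = Far.injective (trans x≡ (sym (elem-farRoot c)))
                     in inj₂ (c , subst (Piece′ i) x≡root p , subst (Conn farGraph _ x) x≡root ε)
    ... | inj₁ x∈F with conn i _ _ p q
    ...   | inj₁ c = [ (λ (d , q′ , c′) → inj₂ (d , at-root q′ , c′))
                       , (λ (_ , c′) → inj₁ (c′ y refl)) ]′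
                       (trace x refl x∈F c)
    ...   | inj₂ (a , _ , c) = [ (λ (d , q′ , c′) → inj₂ (d , at-root q′ , c′))
                               , (λ (a∈F , _) → ⊥-elim (roots∉F a a∈F)) ]′
                               (trace x refl x∈F c)
    meet′ : ∀ i j → i ≢ j → (∀ c → ¬ Piece′ i (farRoot c)) →
            ∃₂ λ x y → Piece′ i x × Piece′ j y × Adj farGraph x y
    meet′ i j i≢j h =
      let v , w , p , q , e = meet i j i≢j (unmet⇒free (unmet h))
          v∈F = unmet⇒⊆F (unmet h) v p
          w∈  = closed v∈F e
          v≡  = Far.elem-index v (inj₁ v∈F)
          w≡  = Far.elem-index w w∈
      in Far.index v (inj₁ v∈F) , Far.index w w∈ ,
         subst (Piece i) (sym v≡) p , subst (Piece j) (sym w≡) q ,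
         subst₂ (Adj H) (sym v≡) (sym w≡) e

  containsPiece-lift : ∀ X′ F′ → (∀ c → ¬ F′ (farRoot c)) → ContainsPiece (β ∘ Far.elem) X′ F′ →
                       ContainsPiece β (Lift far X′) (Lift far F′)
  containsPiece-lift X′ F′ r∉F′ (i , ⊆F′) = i , λ x q →
    let x∈F = unmet⇒⊆F unmet x q
        x≡  = Far.elem-index x (inj₁ x∈F)
    in _ , x≡ , ⊆F′ _ (subst (Piece i) (sym x≡) q)
    where
    unmet : Unmet i
    unmet c q = r∉F′ c (⊆F′ _ (subst (Piece i) (sym (elem-farRoot c)) q))

module ContractedFragments {H z p} {r : Fin z → Vertex H} {β : Vertex H → Maybe (Fin p)}
                           (fragments : Fragments H r β) {u v} (u≢v : u ≢ v) (βu≡βv : β u ≡ β v) where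
  open Contraction H u≢v
  open Fragments fragments

  β′ : Vertex contracted → Maybe (Fin p)
  β′ = β ∘ section

  β′-π : ∀ x → β′ (π x) ≡ β x
  β′-π = respects β βu≡βv

  contractedFragments : Fragments contracted (π ∘ r) β′
  contractedFragments = record
    { conn = λ i x y p q →
        [ (λ c → inj₁ (subst₂ (Conn contracted _) (π-section x) (π-section y) (push-conn push c)))
        , (λ (a , a∈ , c) → inj₂ (a , push (r a) a∈ ,
             subst (λ x → Conn contracted _ x (π (r a))) (π-section x) (push-conn push c))) ]′
        (conn i (section x) (section y) p q)
    ; meet = λ i j i≢j free →
        let x , y , p , q , e = meet i j i≢j (λ a q → free a (push (r a) q))
        in π x , π y , push x p , push y q ,
           push-adj (λ eq → i≢j (just-injective
             (trans (sym (push x p)) (trans (cong β′ eq) (push y q))))) e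
    }
    where
    push : ∀ {i} x → Piece i x → β′ (π x) ≡ just i
    push x = trans (β′-π x)

-- Edges inside root-free pieces are contracted. At a cut, Menger's theorem handles the near side
-- and recursion the far side. Once no such edge is left, each free piece has at most one vertex,
-- any two are adjacent, and Menger's theorem links the roots to them.
rooted-clique : ∀ n H → order H < n → ∀ {z p} → z + z ≤ p →
                (r : Fin z → Vertex H) → Injective _≡_ _≡_ r →
                (β : Vertex H → Maybe (Fin p)) → Fragments H r β →
                NoSmallSeparation H z r (ContainsPiece β) → ¬ ¬ RootedClique H z r
rooted-clique (suc n) H (s≤s H≤n) {z} {p} 2z≤p r r-inj β fragments noSmall = do
  yes (i , u , v , free , u∈ , v∈ , e) ← ¬¬-excluded-middle
    {A = ∃ λ i → ∃₂ λ u v → Free i × Piece i u × Piece i v × Adj H u v}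
    where no ¬edge → base ¬edge
  let u≢v = λ { refl → irreflexive H refl e }
      module C = Contraction H u≢v
      module CF = ContractedFragments fragments u≢v (trans u∈ (sym v∈))
      r≢v = λ { a refl → free a v∈ }
  inj₂ (K , _ , _ , contains , a , a∉F , a∉X) ←
    contract-or-cut r u≢v r-inj r≢v {Blocks′ = ContainsPiece CF.β′} noSmall
      (λ X F (i , h) → i , λ x q → h (C.π x) (trans (CF.β′-π x) q))
    where inj₁ noSmall′ → do
            B , B-rooted , touch ← rooted-clique n C.contracted (<-≤-trans C.size< H≤n) 2z≤p (C.π ∘ r)
              (λ p → r-inj (C.π-injective (r≢v _) (r≢v _) p))
              CF.β′ CF.contractedFragments noSmall′
            let M = contraction-model (C.contracts e)
            return (compose M B , B-rooted , λ a b a≢b → compose-touching M B (touch a b a≢b))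
  let open Sides K
      module FF = FarFragments K fragments contains
  L ← menger _ nearGraph ≤-refl nearRoot (nearRoot-injective r-inj) nearTarget
        (near-noSmallSeparation noSmall contains λ X′ F′ F⊆ _ (i , h) → i , λ x q → F⊆ x (h x q))
  Φ , Φ-rooted , touch ← rooted-clique n farGraph (<-≤-trans (Far.size< (r a) [ a∉F , a∉X ]′) H≤n) 2z≤p
        farRoot farRoot-injective (β ∘ Far.elem) FF.farFragments
        (far-noSmallSeparation noSmall FF.containsPiece-lift)
  let open Join L Φ Φ-rooted
  return (joined , Bunch.label-root joined , λ a b a≢b →
    let v , w , p , q , e = touch (σ a) (σ b) (a≢b ∘ σ-injective)
    in Far.elem v , Far.elem w , joined-far p , joined-far q , e)
  where
  open Fragments fragments
  Target : Vertex H → Set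
  Target w = ∃ λ i → Free i × Piece i w

  -- The `z` roots and fewer than `z` separating vertices touch fewer than `p` pieces. An untouched
  -- piece is free and misses `X`, so it lies wholly in `F`.
  target-noSmall : NoSmallSeparation H z r (Hits Target)
  target-noSmall X F sep r∉F hits m m<z (y , cov) =
    noSmall X F sep r∉F
      (i , λ x q → [ id , (λ x∈X → ⊥-elim (missesX x q x∈X)) ]′ (hits x (i , free , q)))
      m m<z (y , cov)
    where
    g : Fin (z + m) → Maybe (Fin p)
    g = [ β ∘ r , β ∘ y ]′ ∘ splitAt z
    miss = missed (<-≤-trans (+-monoʳ-< z m<z) 2z≤p) g
    i = proj₁ miss
    free : Free i
    free a q = proj₂ miss (a ↑ˡ m) (trans (cong [ β ∘ r , β ∘ y ]′ (splitAt-↑ˡ z a m)) q)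
    missesX : ∀ x → Piece i x → ¬ X x
    missesX x q x∈X = let j , x≡ = cov x x∈X in
      proj₂ miss (z ↑ʳ j) (trans (cong [ β ∘ r , β ∘ y ]′ (splitAt-↑ʳ z m j)) (subst (Piece i) x≡ q))

  base : ¬ (∃ λ i → ∃₂ λ u v → Free i × Piece i u × Piece i v × Adj H u v) → ¬ ¬ RootedClique H z r
  base ¬edge = do
    B , B-rooted , hits ← menger _ H ≤-refl r r-inj Target target-noSmall
    return (B , B-rooted , touch B hits)
    where
    -- A nonempty walk inside a free piece would begin with a contractible edge.
    one : ∀ {i x y} → Free i → Piece i x → Piece i y → x ≡ y
    one {i} {x} {y} free p q with conn i x y p q
    ... | inj₁ ε                   = refl
    ... | inj₁ ((p₁ , p₂ , e) ◅ _) = ⊥-elim (¬edge (i , _ , _ , free , p₁ , p₂ , e))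
    ... | inj₂ (a , a∈ , _)        = ⊥-elim (free a a∈)
    touch : ∀ B → (∀ a → ∃ λ t → Bunch.Class B a t × Target t) → ∀ a b → a ≢ b → Touching B a b
    touch B hits a b a≢b with hits a | hits b
    ... | t , t∈ , i , free , ti | t′ , t′∈ , j , free′ , tj with i ≟ j
    ...   | yes refl = ⊥-elim (a≢b (just-injective
                         (trans (sym t∈) (trans (cong (Bunch.label B) (one free ti tj)) t′∈))))
    ...   | no i≢j = let x , y , p , q , e = meet i j i≢j free in
      t , t′ , t∈ , t′∈ , subst₂ (Adj H) (one free p ti) (one free′ q tj) e

-- Colourings

-- Induction on `s` with one value to spare: drop the value equal to `f zero`, or the first one if
-- there is none.
avoiding : ∀ {s j t} → j + s ≤ t → (f : Fin s → Fin t) →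
           ∃ λ (g : Fin j → Fin t) → Injective _≡_ _≡_ g × ∀ i l → g i ≢ f l
avoiding {zero} {j} {t} j≤t f =
  (λ i → inject≤ i j≤t′) , (λ {a} {b} → inject≤-injective j≤t′ j≤t′ a b) , λ _ ()
  where j≤t′ = subst (_≤ t) (+-identityʳ j) j≤t
avoiding {suc s} {j} {t} j+s≤t f with avoiding {s} {suc j} (subst (_≤ t) (+-suc j s) j+s≤t) (f ∘ suc)
... | g , g-inj , g≢ with any? (λ i → g i ≟ f zero)
...   | yes (i , e) = g ∘ punchIn i , (λ e′ → punchIn-injective i _ _ (g-inj e′)) , λ
          { a zero    e′ → punchInᵢ≢i i a (g-inj (trans e′ (sym e)))
          ; a (suc l) → g≢ _ l }
...   | no ¬e = g ∘ suc , (λ e′ → suc-injective (g-inj e′)) , λ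
          { a zero    e′ → ¬e (suc a , e′)
          ; a (suc l) → g≢ _ l }

transpose-injective : ∀ {n} (i j : Fin n) → Injective _≡_ _≡_ (transpose i j)
transpose-injective i j e =
  trans (sym (transpose-inverse j i)) (trans (cong (transpose j i) e) (transpose-inverse j i))

transpose-left : ∀ {n} (i j : Fin n) → transpose i j i ≡ j
transpose-left i j rewrite dec-true (i ≟ i) refl = refl

transpose-fixes : ∀ {n} {i j k : Fin n} → k ≢ i → k ≢ j → transpose i j k ≡ k
transpose-fixes {i = i} {j} {k} k≢i k≢j rewrite dec-false (k ≟ i) k≢i | dec-false (k ≟ j) k≢j = refl

-- Swapping `ρ (f zero)` with `g zero` corrects the first value and, by injectivity, moves none of
-- the others.
permuting : ∀ {s t} (f g : Fin s → Fin t) → Injective _≡_ _≡_ f → Injective _≡_ _≡_ g →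
            ∃ λ (ρ : Fin t → Fin t) → Injective _≡_ _≡_ ρ × ∀ i → ρ (f i) ≡ g i
permuting {zero}  f g f-inj g-inj = id , id , λ ()
permuting {suc s} f g f-inj g-inj =
  transpose a b ∘ ρ , ρ-inj ∘ transpose-injective a b , λ
    { zero    → transpose-left a b
    ; (suc i) → trans (transpose-fixes
        (λ e → case-suc (f-inj (ρ-inj e)))
        (λ e → case-suc (g-inj (trans (sym (ρf≡g i)) e)))) (ρf≡g i) }
  where
  rec = permuting (f ∘ suc) (g ∘ suc) (suc-injective ∘ f-inj) (suc-injective ∘ g-inj)
  ρ = proj₁ rec
  ρ-inj = proj₁ (proj₂ rec)
  ρf≡g = proj₂ (proj₂ rec)
  a = ρ (f zero)
  b = g zero
  case-suc : ∀ {n} {i : Fin n} → suc i ≢ zero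
  case-suc ()

colourable-mono : ∀ {G i j} → i ≤ j → Colourable i G → Colourable j G
colourable-mono i≤j (c , proper) =
  (λ x → inject≤ (c x) i≤j) , λ x y e eq → proper x y e (inject≤-injective i≤j i≤j _ _ eq)

colourable-order : ∀ G → Colourable (order G) G
colourable-order G = id , λ { x y e refl → irreflexive G refl e }

chromatic-unique : ∀ {G i j} → Chromatic i G → Chromatic j G → i ≡ j
chromatic-unique (c , min) (c′ , min′) = ≤-antisym (min _ c′) (min′ _ c)

chromatic-exists : ∀ G → ¬ ¬ ∃ λ j → Chromatic j G
chromatic-exists G = least (λ j → Colourable j G) (order G) (colourable-order G)

K-adj : ∀ {n} {x y : Fin n} → x ≢ y → Adj (K n) x y
K-adj = fromWitness

K-adj⁻ : ∀ {n} {x y : Fin n} → Adj (K n) x y → x ≢ y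
K-adj⁻ = toWitness

K-mono : ∀ {m n} → m ≤ n → K m IsSubgraphOf K n
K-mono m≤n = record
  { embed = λ i → inject≤ i m≤n
  ; injective = λ {i} {j} → inject≤-injective m≤n m≤n i j
  ; preserves = λ {i} {j} e → K-adj λ eq → K-adj⁻ {x = i} {j} e (inject≤-injective m≤n m≤n i j eq) }

-- Minimal counterexamples

smaller⇒proper : ∀ {H G} → Model H G → order H < order G → H IsProperMinorOf G
smaller⇒proper M H<G = model⇒minor M , λ iso →
  n≮n _ (subst (_< _) (↔⇒≡ (_≅_.bijection iso)) H<G)

module Minimal {k G} (chromatic : Chromatic (suc k) G) (minimal : MinimalHadwigerCounterexample G) where

  noClique : ¬ (K (suc k) IsMinorOf G)
  noClique m = let (j , chromatic′ , ∌K) , _ = minimal in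
    ∌K (subst (λ i → K i IsMinorOf G) (chromatic-unique {G} chromatic chromatic′) m)

  notColourable : ¬ Colourable k G
  notColourable c = n≮n _ (proj₂ chromatic k c)

  hadwiger : ∀ {H j} → Model H G → order H < order G → Chromatic j H → ¬ ¬ Model (K j) H
  hadwiger M H<G χ ¬M = proj₂ minimal _ (smaller⇒proper M H<G) (_ , χ , λ m → ¬M (minor⇒model m))

  -- Otherwise the chromatic number `j` of `H` exceeds `k`; by minimality `H` has a `K j` minor, and
  -- `G` a `K (suc k)` minor.
  minorColourable : ∀ {H} → Model H G → order H < order G → ¬ ¬ Colourable k H
  minorColourable {H} M H<G = do
    j , χ ← chromatic-exists H
    N ← hadwiger M H<G χ
    inj₂ j≤k ← return (≤-<-connex (suc k) j)
      where inj₁ k<j → λ _ → noClique (model⇒minor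
              (model-trans M (model-trans N (subgraph-model (K-mono k<j)))))
    return (colourable-mono {H} (≤-pred j≤k) (proj₁ χ))

-- Colouring across a separation

induced-subgraph : ∀ G {P} (E : Enumeration P) → induced G E IsSubgraphOf G
induced-subgraph G E = record { embed = elem E ; injective = Enumeration.injective E ; preserves = id }

extend : ∀ {n} {P : Fin n → Set} {A : Set} (E : Enumeration P) → (∀ x → Dec (P x)) →
         (f : Fin (Enumeration.size E) → A) → ∃ P → ∃ λ (g : Fin n → A) → ∀ x p → g x ≡ f (index E x p)
extend {n} {P} {A} E P? f (x₀ , p₀) = g , g≡
  where
  g : Fin n → A
  g x with P? x
  ... | yes p = f (index E x p)
  -- An arbitrary default off `P`; the point `x₀` guarantees that one exists.
  ... | no _  = f (index E x₀ p₀)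
  g≡ : ∀ x p → g x ≡ f (index E x p)
  g≡ x p with P? x
  ... | yes p′ = cong f (Enumeration.injective E (trans (elem-index E x p′) (sym (elem-index E x p))))
  ... | no ¬p  = ⊥-elim (¬p p)

ProperOn : ∀ {k} (G : Graph) → (Vertex G → Set) → (Vertex G → Fin k) → Set
ProperOn G P c = ∀ x y → P x → P y → Adj G x y → c x ≢ c y

induced-colouring : ∀ {G k} {P : Vertex G → Set} (E : Enumeration P) → (∀ x → Dec (P x)) → ∃ P →
                    Colourable k (induced G E) → ∃ λ (c : Vertex G → Fin k) → ProperOn G P c
induced-colouring {G} E P? ∃P (f , proper) =
  let c , c≡ = extend E P? f ∃P in
  c , λ x y p q e eq → proper (index E x p) (index E y q)
        (subst₂ (Adj G) (sym (elem-index E x p)) (sym (elem-index E y q)) e)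
        (trans (sym (c≡ x p)) (trans eq (c≡ y q)))

-- An edge leaving `F` ends in `X`, so `cross` deals with every edge whose ends are coloured by
-- different maps.
glue : ∀ {G k} {X F : Vertex G → Set} → Separation G X F → (∀ w → Dec (F w)) →
       (c d : Vertex G → Fin k) → ProperOn G (¬_ ∘ F) c → ProperOn G F d →
       (∀ x y → F x → X y → Adj G x y → d x ≢ c y) → Colourable k G
glue {G} {k} {X} {F} sep F? c d c-proper d-proper cross = mix , proper
  where
  choose : ∀ x → Dec (F x) → Fin k
  choose x (yes _) = d x
  choose x (no _)  = c x
  mix : Vertex G → Fin k
  mix x = choose x (F? x)
  across : ∀ {x y} → F x → ¬ F y → Adj G x y → d x ≢ c y
  across f ¬f e = [ (λ f′ → ⊥-elim (¬f f′)) , (λ x → cross _ _ f x e) ]′ (Separation.closed sep f e)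
  proper : ∀ x y → Adj G x y → mix x ≢ mix y
  proper x y e with F? x | F? y
  ... | yes p | yes q = d-proper x y p q e
  ... | yes p | no q  = across p q e
  ... | no p  | yes q = ≢-sym (across q p (symmetric G e))
  ... | no p  | no q  = c-proper x y p q e

NoSplit : Graph → ℕ → Set₁
NoSplit G m = ∀ X F → Separation G X F → Covered m X → ∃ F → ¬ ∃ λ w → ¬ F w × ¬ X w

Rainbow : ∀ {k s} (G : Graph) → (Fin s → Vertex G) → (Vertex G → Set) → Set
Rainbow {k} G y F = ∃ λ (c : Vertex G → Fin k) → ProperOn G (¬_ ∘ F) c × Injective _≡_ _≡_ (c ∘ y)

-- Contracting a clique model on the far side that is rooted at X turns X into a clique, and colouring
-- the resulting proper minor gives the near side a colouring which is injective on X.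
rainbow : ∀ {k G} → Chromatic (suc k) G → MinimalHadwigerCounterexample G →
          ∀ {s} → s + s + s ≤ k → (∀ m → m < s → NoSplit G m) →
          ∀ {X F} → (∀ w → Dec (X w)) → (∀ w → Dec (F w)) → Separation G X F →
          ∀ y → Injective _≡_ _≡_ y → (∀ i → X (y i)) → Covers {s} y X →
          ∃ F → (∃ λ w → ¬ F w × ¬ X w) → ¬ ¬ Rainbow {k} G y F
rainbow {k} {G} chromatic minimal {s} 3s≤k noSplit {X} {F} X? F? sep y y-inj y∈X cover
        inner@(f₀ , F-f₀) (g₀ , ¬F-g₀ , _) = do
  nearColouring ← minorColourable (subgraph-model (induced-subgraph G near)) near<
  j , χ ← chromatic-exists inside
  inj₁ 2s≤j ← return (≤-<-connex (s + s) j)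
    where inj₂ j<2s → λ _ → few-colours nearColouring (<⇒≤ j<2s) (proj₁ χ)
  N ← hadwiger (subgraph-model (induced-subgraph G E)) (E.size< g₀ ¬F-g₀) χ
  Φ , Φ-rooted , touch ← rooted-clique-far (model-trans N (subgraph-model (K-mono 2s≤j)))
  near-rainbow Φ Φ-rooted touch
  where
  open Minimal chromatic minimal
  -- The separator is its own set of roots, so `nearRoot` and `farRoot` both list `X`.
  K₀ : Cut G s y
  K₀ = record { X = X ; F = F ; X? = X? ; F? = F? ; separation = sep
              ; roots∉F = λ a → Separation.disjoint sep (y∈X a)
              ; y = y ; y-injective = y-inj ; y∈X = y∈X ; cover = cover }
  open Sides K₀ hiding (X; F; X?; F?; y; y∈X; cover)
  E : Enumeration F
  E = enumerate F?
  module E = Enumeration E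
  inside : Graph
  inside = induced G E
  near< : Near.size < order G
  near< = Near.size< f₀ λ ¬F-f₀ → ¬F-f₀ F-f₀

  -- The near colouring uses at most `s` colours on `X`. As `j + s ≤ 3 * s ≤ k`, there remain `j`
  -- other colours for `F`.
  few-colours : ∀ {j} → Colourable k nearGraph → j ≤ s + s → ¬ Colourable j inside
  few-colours {j} nearColouring j≤2s insideColouring =
    let c , c-proper = induced-colouring {G} near (¬? ∘ F?) (g₀ , ¬F-g₀) nearColouring
        d , d-proper = induced-colouring {G} E F? inner insideColouring
        h , h-inj , h≢ = avoiding (≤-trans (+-monoˡ-≤ s j≤2s) 3s≤k) (c ∘ y)
    in notColourable (glue sep F? c (h ∘ d) c-proper
         (λ x y p q e eq → d-proper x y p q e (h-inj eq))
         (λ x w _ w∈X _ eq → let i , w≡ = cover w w∈X in h≢ (d x) i (trans eq (cong c w≡))))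

  rooted-clique-far : Model (K (s + s)) inside → ¬ ¬ RootedClique farGraph s farRoot
  rooted-clique-far M = rooted-clique _ farGraph ≤-refl ≤-refl farRoot farRoot-injective M′.label
    (record { conn = λ i x y p q → inj₁ (M′.class-conn p q)
            ; meet = λ i j i≢j _ → M′.edges i j (K-adj i≢j) })
    (far-noSmallSeparation {Blocks = λ _ F → ∃ F} noSmall
      λ X′ F′ _ (i , ⊆F′) → _ , _ , refl , ⊆F′ _ (M′.label-root i))
    where
    inside⊆far : inside IsSubgraphOf farGraph
    inside⊆far = record
      { embed = λ i → Far.index (E.elem i) (inj₁ (E.sound i))
      ; injective = λ e → E.injective (Far.index-injective e)
      ; preserves = subst₂ (Adj G) (sym (Far.elem-index _ _)) (sym (Far.elem-index _ _)) }
    module M′ = Model (model-trans (subgraph-model inside⊆far) M)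
    -- The `s` distinct vertices `y a` do not all fit into `X′`. One of them lies beyond `F′` and
    -- `X′`, so a nonempty `F′` would split `G`.
    noSmall : NoSmallSeparation G s y (λ _ F → ∃ F)
    noSmall X′ F′ sep′ y∉F′ ∃F′ m m<s cov@(y′ , cov′) =
      decide X′ λ X′? →
        let a , a∉X′ = ¬∀⟶∃¬ s (X′ ∘ y) (X′? ∘ y) λ h → n≮n _ (≤-<-trans (injective⇒≤
              {f = λ a → proj₁ (cov′ (y a) (h a))}
              (λ {a} {b} e → y-inj (trans (proj₂ (cov′ (y a) (h a)))
                (trans (cong y′ e) (sym (proj₂ (cov′ (y b) (h b)))))))) m<s)
        in noSplit m m<s X′ F′ sep′ cov ∃F′ (y a , y∉F′ a , a∉X′)

  near-rainbow : (Φ : Bunch farGraph (Fin s)) → Rooted Φ farRoot → (∀ a b → a ≢ b → Touching Φ a b) →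
                 ¬ ¬ Rainbow {k} G y F
  near-rainbow Φ Φ-rooted touch = do
    f , f-proper ← minorColourable model near<
    let c , c≡ = extend near (¬? ∘ F?) f (g₀ , ¬F-g₀)
    return (c
      , (λ x w p q e eq → f-proper _ _
          (completed-adj (inj₁
            (subst₂ (Adj G) (sym (Near.elem-index x p)) (sym (Near.elem-index w q)) e)))
          (trans (sym (c≡ x p)) (trans eq (c≡ w q))))
      , λ {i} {j} eq → decidable-stable (i ≟ j) λ i≢j → f-proper _ _
          (completed-adj (inj₂ (i≢j ∘ nearRoot-injective y-inj , root∈X i , root∈X j)))
          (trans (sym (c≡ _ _)) (trans eq (c≡ _ _))))
    where
    module Φ = Bunch Φ
    root∈X : ∀ i → X (Near.elem (nearRoot i))
    root∈X i = subst X (sym (Near.elem-index _ _)) (y∈X i)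
    R : Rel (Fin Near.size) 0ℓ
    R i j = Adj G (Near.elem i) (Near.elem j) ⊎ (i ≢ j × X (Near.elem i) × X (Near.elem j))
    R? : ∀ i j → Dec (R i j)
    R? i j = Adj? G _ _ ⊎-dec (¬? (i ≟ j) ×-dec X? _ ×-dec X? _)
    completed : Graph
    completed = spanned Near.size R?
      [ inj₁ ∘ symmetric G , (λ (i≢j , p , q) → inj₂ (≢-sym i≢j , q , p)) ]′
      (λ i → [ irreflexive G refl , (λ (i≢i , _) → i≢i refl) ]′)
    completed-adj : ∀ {i j} → R i j → Adj completed i j
    completed-adj = fromWitness

    -- Each far class is absorbed into the vertex of `X` that is its root; vertices of `F` in no
    -- class are deleted.
    label : Vertex G → Maybe (Fin Near.size)
    label v with F? v
    ... | yes f = Maybe.map nearRoot (Φ.label (Far.index v (inj₁ f)))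
    ... | no ¬f = just (Near.index v ¬f)
    label-near : ∀ i → label (Near.elem i) ≡ just i
    label-near i with F? (Near.elem i)
    ... | yes f = ⊥-elim (Near.sound i f)
    ... | no ¬f = cong just (Near.index-elem i ¬f)
    label-y : ∀ c → label (y c) ≡ just (nearRoot c)
    label-y c = subst (λ w → label w ≡ just (nearRoot c)) (Near.elem-index _ _) (label-near (nearRoot c))
    label-far : ∀ i {c} → Φ.Class c i → label (Far.elem i) ≡ just (nearRoot c)
    label-far i {c} p with Far.sound i
    ... | inj₂ x = let d , e = cover _ x
                       i≡ = Far.injective (trans e (sym (elem-farRoot d)))
                       d≡c = just-injective (trans (sym (Φ-rooted d)) (trans (cong Φ.label (sym i≡)) p))
                   in trans (cong label e) (trans (label-y d) (cong (just ∘ nearRoot) d≡c))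
    ... | inj₁ f with F? (Far.elem i)
    ...   | yes f′ = cong (Maybe.map nearRoot) (trans (cong Φ.label (Far.index-elem i (inj₁ f′))) p)
    ...   | no ¬f  = ⊥-elim (¬f f)
    label⁻ : ∀ v {h} → label v ≡ just h →
             v ≡ Near.elem h ⊎ (∃₂ λ c i → h ≡ nearRoot c × Far.elem i ≡ v × Φ.Class c i)
    label⁻ v p with F? v
    label⁻ v refl | no ¬f = inj₁ (sym (Near.elem-index v ¬f))
    label⁻ v p | yes f with Φ.label (Far.index v (inj₁ f)) in q
    label⁻ v refl | yes f | just c = inj₂ (c , _ , refl , Far.elem-index v (inj₁ f) , q)
    far-conn : ∀ c i → Φ.Class c i →
               Conn G (λ w → label w ≡ just (nearRoot c)) (Far.elem i) (Near.elem (nearRoot c))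
    far-conn c i p = subst (Conn G _ _) (trans (elem-farRoot c) (sym (Near.elem-index _ _)))
      (gmap Far.elem (λ (p , q , e) → label-far _ p , label-far _ q , e) (Φ.class-conn p (Φ-rooted c)))

    label-conn : ∀ v h → v ≡ Near.elem h ⊎ (∃₂ λ c i → h ≡ nearRoot c × Far.elem i ≡ v × Φ.Class c i) →
                 Conn G (λ w → label w ≡ just h) v (Near.elem h)
    label-conn v h (inj₁ refl)                         = ε
    label-conn v h (inj₂ (c , i , refl , refl , p)) = far-conn c i p

    model : Model completed G
    model = record
      { bunch = record
        { label = label ; root = Near.elem ; label-root = label-near
        ; conn = λ {v} {h} p → label-conn v h (label⁻ v p) }
      ; edges = λ a b e → edge a b (toWitness {a? = R? a b} e)
      }
      where
      Touch = λ a b → ∃₂ λ x y → label x ≡ just a × label y ≡ just b × Adj G x y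
      edge : ∀ a b → R a b → Touch a b
      edge a b (inj₁ e) = _ , _ , label-near a , label-near b , e
      edge a b (inj₂ (a≢b , a∈X , b∈X)) =
        let c , a≡ = cover _ a∈X
            d , b≡ = cover _ b∈X
            a≡root = Near.injective {a} {nearRoot c} (trans a≡ (sym (Near.elem-index _ _)))
            b≡root = Near.injective {b} {nearRoot d} (trans b≡ (sym (Near.elem-index _ _)))
            v , w , p , q , e = touch c d λ c≡d →
              a≢b (trans a≡root (trans (cong nearRoot c≡d) (sym b≡root)))
        in Far.elem v , Far.elem w , trans (label-far v p) (cong just (sym a≡root)) ,
           trans (label-far w q) (cong just (sym b≡root)) , e

-- Induction on `s`, bounded by `n`: smaller separators are already excluded, so the cover of `X` is
-- minimal and lists `X` without repetition.
no-split : ∀ {k G} → Chromatic (suc k) G → MinimalHadwigerCounterexample G →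
           ∀ n s → s < n → s + s + s ≤ k → NoSplit G s
no-split {k} {G} chromatic minimal (suc n) s (s≤s s≤n) 3s≤k X F sep (y , cover) inner outer =
  absurd id
  where
  open Minimal chromatic minimal
  smaller : ∀ m → m < s → NoSplit G m
  smaller m m<s = no-split chromatic minimal n m (<-≤-trans m<s s≤n)
    (≤-trans (+-mono-≤ (+-mono-≤ (<⇒≤ m<s) (<⇒≤ m<s)) (<⇒≤ m<s)) 3s≤k)
  module Y = MinimalCover cover (λ m m<s cov → smaller m m<s X F sep cov inner outer)
  F′ : Vertex G → Set
  F′ w = ¬ F w × ¬ X w
  module _ (X? : ∀ w → Dec (X w)) (F? : ∀ w → Dec (F w)) where
    F′? : ∀ w → Dec (F′ w)
    F′? w = ¬? (F? w) ×-dec ¬? (X? w)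
    sep′ : Separation G X F′
    sep′ = record { disjoint = λ x (_ , ¬x) → ¬x x ; closed = closed′ }
      where
      closed′ : ∀ {v w} → F′ v → Adj G v w → F′ w ⊎ X w
      closed′ {v} {w} (¬f , ¬x) e with X? w
      ... | yes x = inj₂ x
      ... | no ¬x′ = inj₁ ((λ f → [ ¬f , ¬x ]′ (Separation.closed sep f (symmetric G e))) , ¬x′)
    -- The domains of `c` and `d` both include `X`. Once `ρ` makes the colours agree there, edges
    -- from `F` to `X` are handled by `d` alone.
    combine : Rainbow {k} G y F → Rainbow {k} G y F′ → ⊥
    combine (c , c-proper , c-inj) (d , d-proper , d-inj) =
      let ρ , ρ-inj , ρd≡c = permuting (d ∘ y) (c ∘ y) d-inj c-inj
          F⇒¬F′ = λ {x} (f : F x) → λ ((¬f , _) : F′ x) → ¬f f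
      in notColourable (glue sep F? c (ρ ∘ d) c-proper
           (λ x w p q e eq → d-proper x w (F⇒¬F′ p) (F⇒¬F′ q) e (ρ-inj eq))
           (λ x w p w∈X e eq → d-proper x w (F⇒¬F′ p) (λ (_ , ¬x) → ¬x w∈X) e (ρ-inj
             (let i , w≡ = cover w w∈X in
              trans eq (trans (cong c w≡) (trans (sym (ρd≡c i)) (cong (ρ ∘ d) (sym w≡))))))))
  absurd : ¬ ¬ ⊥
  absurd = do
    X? ← decide X
    F? ← decide F
    y∈X ← ¬¬-∀ Y.exact
    c ← rainbow chromatic minimal 3s≤k smaller X? F? sep y Y.injective y∈X cover inner outer
    -- The sides are exchanged: a vertex of `F` now witnesses that something lies outside `F′` and
    -- `X`.
    d ← rainbow chromatic minimal 3s≤k smaller X? (F′? X? F?) (sep′ X? F?) y Y.injective y∈X cover outer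
          (let f₀ , f = inner in f₀ , (λ (¬f , _) → ¬f f) , λ x → Separation.disjoint sep x f)
    return (combine X? F? c d)

-- From separations to connectivity

covered-by-subset : ∀ {n} (S : Subset n) → Covered ∣ S ∣ (_∈ S)
covered-by-subset []            = (λ ()) , λ ()
covered-by-subset (false ∷ S) =
  let y , cov = covered-by-subset S in
  suc ∘ y , λ { (suc w) (there p) → let i , e = cov w p in i , cong suc e }
covered-by-subset (true ∷ S)  =
  let y , cov = covered-by-subset S in
  (λ { zero → zero ; (suc i) → suc (y i) }) , λ
    { zero    here      → zero , refl
    ; (suc w) (there p) → let i , e = cov w p in suc i , cong suc e }

-- If `y` were unreachable, `S` would split the component of `x` in `G − S` from `y`.
connectedOutside : ∀ {k G} → Chromatic (suc k) G → MinimalHadwigerCounterexample G →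
                   ∀ S → ∣ S ∣ + ∣ S ∣ + ∣ S ∣ ≤ k → ConnectedOutside G S
connectedOutside {G = G} chromatic minimal S 3s≤k x y x∉S y∉S =
  decidable-stable (star? (λ v w → ¬? (v ∈? S) ×-dec ¬? (w ∈? S) ×-dec Adj? G v w) x y) λ ¬c →
    no-split chromatic minimal _ ∣ S ∣ ≤-refl 3s≤k (_∈ S) (Star (AdjOutside G S) x)
      (record { disjoint = λ w∈S c → end c w∈S ; closed = closed })
      (covered-by-subset S) (x , ε) (y , ¬c , y∉S)
  where
  outside-all : ∀ {v w} → v ∉ S → Star (AdjOutside G S) v w → w ∉ S
  outside-all v∉ ε                   = v∉
  outside-all v∉ ((_ , w∉ , _) ◅ c) = outside-all w∉ c
  end : ∀ {w} → Star (AdjOutside G S) x w → w ∉ S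
  end = outside-all x∉S
  closed : ∀ {v w} → Star (AdjOutside G S) x v → Adj G v w → Star (AdjOutside G S) x w ⊎ w ∈ S
  closed {v} {w} c e with w ∈? S
  ... | yes w∈S = inj₂ w∈S
  ... | no w∉S  = inj₁ (c ◅◅ (end c , w∉S , e) ◅ ε)

theorem3 : (k : ℕ) → .{{_ : NonZero k}} → (G : Graph) → Chromatic k G → MinimalHadwigerCounterexample G → Connected ⌈ k /8⌉ G
theorem3 (suc k) G chromatic minimal =
  <-≤-trans (bound k k≢0) k<order , λ S S< → connectedOutside chromatic minimal S (small S<)
  where
  k<order : suc k ≤ order G
  k<order = proj₂ chromatic _ (colourable-order G)
  -- A 1-chromatic graph has a vertex, hence a `K 1` minor. This rules out the one case where
  -- `bound` fails, as `⌈ 1 /8⌉` is 1.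
  k≢0 : k ≢ 0
  k≢0 refl = Minimal.noClique chromatic minimal (model⇒minor (subgraph-model record
    { embed = λ _ → fromℕ< k<order
    ; injective = λ { {zero} {zero} _ → refl }
    ; preserves = λ { {zero} {zero} () } }))
  bound : ∀ k → k ≢ 0 → ⌈ suc k /8⌉ < suc k
  bound zero    k≢0 = ⊥-elim (k≢0 refl)
  -- The claim is `k + 9 < (k + 2) * 8`; removing three successors leaves `k + 7 ≤ 13 + k * 8`.
  bound (suc k) _   = m<n*o⇒m/o<n {suc (suc k) + 7} {suc (suc k)} {8}
    (s≤s (s≤s (s≤s (subst (k + 7 ≤_) (+-comm (k * 8) 13) (+-mono-≤ (m≤m*n k 8) (m≤m+n 7 6))))))
  -- The ceiling gives `suc s * 8 ≤ k + 8`, that is `s * 8 ≤ k`.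
  small : ∀ {s} → s < ⌈ suc k /8⌉ → s + s + s ≤ k
  small {s} s< = begin
    s + s + s  ≡⟨ trans (+-assoc s s s) (cong (λ t → s + (s + t)) (sym (+-identityʳ s))) ⟩
    3 * s      ≤⟨ *-monoˡ-≤ s (m≤m+n 3 5) ⟩
    8 * s      ≡⟨ *-comm 8 s ⟩
    s * 8      ≤⟨ +-cancelˡ-≤ 8 (s * 8) k (begin
      suc s * 8            ≤⟨ *-monoˡ-≤ 8 s< ⟩
      ⌈ suc k /8⌉ * 8      ≤⟨ m/n*n≤m (suc k + 7) 8 ⟩
      suc k + 7            ≡⟨ +-comm (suc k) 7 ⟩
      7 + suc k            ≡⟨ +-suc 7 k ⟩
      8 + k                ∎) ⟩
    k          ∎
    where open ≤-Reasoning
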